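{- For a nonnegative integer $n$, define the Apéry polynomial $A_n(x)=\sum_{k=0}^{n}\binom{n}{k}^2\binom{n+k}{k}^2x^k$, and write $A_n=A_n(1)$. Let $x\in\mathbb{Z}$. (i) For every positive integer $n$, $$\sum_{k=0}^{n-1}(-1)^k(2k+1)A_k(x)\equiv 0\pmod n.$$ (ii) For every odd prime $p$, $$\frac{1}{p}\sum_{k=0}^{p-1}(-1)^k(2k+1)A_k(x)\equiv\left(\frac{1-4x}{p}\right)\pmod p,$$ where $\left(\frac{\cdot}{p}\right)$ is the Legendre symbol. (iii) For every prime $p>3$, $$\frac{1}{p}\sum_{k=0}^{p-1}(-1)^k(2k+1)A_k\equiv\left(\frac{p}{3}\right)\pmod{p^2},$$ and $$\frac{1}{p}\sum_{k=0}^{p-1}(-1)^k(2k+1)A_k(-2)\equiv 1-\frac{4}{3}\left(2^{p-1}-1\right)\pmod{p^2}.$$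
   Context: Congruences between rationals whose denominators are prime to the modulus are understood in the usual way (e.g. $\frac{4}{3}$ modulo $p^2$ for $p>3$). $\left(\frac{a}{p}\right)$ denotes the Legendre symbol modulo $p$, and $\left(\frac{p}{3}\right)$ the Legendre symbol modulo $3$. -}

module Defs where

open import Data.Nat as ℕ using (ℕ; zero; suc; NonZero)
open import Data.Nat.Combinatorics using (_C_)
open import Data.Integer using (ℤ; +_; -_; _+_; _*_; _^_; -1ℤ; 0ℤ; 1ℤ)
open import Data.Integer.DivMod using (_%ℕ_)
open import Data.Bool using (Bool; true; false; if_then_else_)
open import Data.List using (List; upTo)
open import Data.Bool.ListAction using (any)

sumTo : ℕ → (ℕ → ℤ) → ℤ
sumTo zero    f = 0ℤ
sumTo (suc n) f = sumTo n f + f n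

apery : ℕ → ℤ → ℤ
apery n x = sumTo (suc n) (λ k → + ((n C k) ℕ.^ 2 ℕ.* ((n ℕ.+ k) C k) ℕ.^ 2) * x ^ k)

aperySum : ℕ → ℤ → ℤ
aperySum n x = sumTo n (λ k → (-1ℤ ^ k) * (+ (2 ℕ.* k ℕ.+ 1)) * apery k x)

-- Legendre symbol (a / p) for p prime: 0 if p ∣ a, 1 if a is a nonzero
-- square mod p (some y ∈ {0,…,p-1} has y² ≡ a mod p), -1 otherwise.
-- (p = 0 never occurs for a prime; it is given the dummy value 0.)
legendre : ℤ → ℕ → ℤ
legendre a zero = 0ℤ
legendre a p@(suc _) with a %ℕ p
... | zero = 0ℤ
... | r@(suc _) =
  if any (λ y → (y ℕ.* y) ℕ.% p ℕ.≡ᵇ r) (upTo p) then 1ℤ else -1ℤ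

legendre3 : ℕ → ℤ
legendre3 p with p ℕ.% 3
... | 0 = 0ℤ
... | 1 = 1ℤ
... | _ = -1ℤ

{-# OPTIONS --safe #-}

-- Put u_k(m) = C(m,k) C(m+k,k), so that A_m(x) = Σ_k u_k(m)² x^k.  The linearization
-- u_k(m)² = Σ_l C(2k,l) C(l,k)² u_l(m) and the telescoping sum
-- Σ_{m<n} (-1)^m (2m+1) u_l(m) = (-1)^(n-1) n C(n-1,l) C(n+l,l) give part (i), with quotient
-- (-1)^(n-1) Σ_l C(n-1,l) C(n+l,l) Σ_k C(2k,l) C(l,k)² x^k.
--
-- For an odd prime n = p we have C(p-1,l) C(p+l,l) ≡ (-1)^l mod p².  Moreover
-- Σ_l (-1)^l C(2k,l) C(l,k)² = C(2k,k), where the terms with l ≥ p vanish mod p² because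
-- p ∣ C(l,k).  Hence the quotient is ≡ Σ_{k<p} C(2k,k) x^k mod p².
--
-- With p = 2h + 1, C(2k,k) ≡ (-4)^k C(h,k) mod p turns this sum into (1 - 4x)^h, and (ii) is
-- Euler's criterion.  For (iii), Σ_{k<n} C(2k,k) x^k is the coefficient of T^n in
-- (1 + xT)^(2n) T / (1 - (1-2x)T + x²T²), which for n = p is ≡ 2 U_p(1,x) - U_p(1-2x,x²) mod p²
-- for the Lucas sequences U_n(P,Q); both are explicit for x = 1 and x = -2.

module Submission where

open import Defs
open import Data.Nat as ℕ using (ℕ; suc; _>_; NonZero)
open import Data.Nat.Primality using (Prime)
open import Data.Integer using (ℤ; +_; _+_; _-_; _*_; _^_; -_)
open import Data.Integer.Divisibility using (_∣_)
open import Data.Product using (_×_)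
open import Relation.Binary.PropositionalEquality using (_≡_)
open import Data.Bool using (Bool; true; false; T)
open import Data.Bool.ListAction using (any)
open import Data.Integer using (-1ℤ; 0ℤ; 1ℤ; ∣_∣)
open import Data.Integer.DivMod using (_%ℕ_; _/ℕ_; n%ℕd<d; a≡a%ℕn+[a/ℕn]*n)
import Data.Integer.Divisibility.Signed as Signed
import Data.Integer.Properties as ℤ
open import Data.Integer.Tactic.RingSolver using (solve-∀)
open import Data.List using (upTo)
open import Data.List.Membership.Propositional using (lose)
open import Data.List.Membership.Propositional.Properties using (∈-upTo⁺)
open import Data.List.Relation.Unary.Any using (satisfied)
open import Data.List.Relation.Unary.Any.Properties using (any⁺; any⁻)
open import Data.Nat using (zero; s≤s; z≤n)
open import Data.Nat.Combinatorics using (_C_; nCk+nC[k+1]≡[n+1]C[k+1])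
import Data.Nat.Divisibility as ℕ using (_∣_; divides; ∣⇒≤; ∣m∣n⇒∣m+n; _∣0)
import Data.Nat.DivMod as ℕ using (m%n<n; m≡m%n+[m/n]*n)
open import Data.Nat.Primality using (euclidsLemma; prime⇒nonZero; prime⇒irreducible)
import Data.Nat.Properties as ℕ
open import Data.Product using (_,_; ∃)
open import Data.Sum using (_⊎_; inj₁; inj₂)
open import Data.Unit using (tt)
open import Data.Vec using (Vec; []; _∷_)
open import Function using (_∘_)
open import Level using (0ℓ)
open import Relation.Binary using (Setoid; tri<; tri≈; tri>)
open import Relation.Binary.PropositionalEquality
  using (_≢_; refl; sym; trans; cong; cong₂; subst; module ≡-Reasoning)
import Relation.Binary.Reasoning.Setoid as SetoidReasoning
open import Relation.Nullary using (¬_; contradiction)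

-- Sums and binomial coefficients

sum-cong : ∀ n {f g : ℕ → ℤ} → (∀ i → i ℕ.< n → f i ≡ g i) → sumTo n f ≡ sumTo n g
sum-cong zero    _ = refl
sum-cong (suc n) h = cong₂ _+_ (sum-cong n λ i i<n → h i (ℕ.m<n⇒m<1+n i<n)) (h n ℕ.≤-refl)

sum-zero : ∀ n {f : ℕ → ℤ} → (∀ i → i ℕ.< n → f i ≡ 0ℤ) → sumTo n f ≡ 0ℤ
sum-zero zero    _ = refl
sum-zero (suc n) h = cong₂ _+_ (sum-zero n λ i i<n → h i (ℕ.m<n⇒m<1+n i<n)) (h n ℕ.≤-refl)

sum-+ : ∀ n (f g : ℕ → ℤ) → sumTo n (λ i → f i + g i) ≡ sumTo n f + sumTo n g
sum-+ zero    f g = refl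
sum-+ (suc n) f g = trans (cong (_+ (f n + g n)) (sum-+ n f g)) (ring (sumTo n f) (sumTo n g) (f n) (g n))
  where
  ring : ∀ a b c d → (a + b) + (c + d) ≡ (a + c) + (b + d)
  ring = solve-∀

sum-* : ∀ n c (f : ℕ → ℤ) → sumTo n (λ i → c * f i) ≡ c * sumTo n f
sum-* zero    c f = sym (ℤ.*-zeroʳ c)
sum-* (suc n) c f = trans (cong (_+ c * f n) (sum-* n c f)) (sym (ℤ.*-distribˡ-+ c _ _))

sum-swap : ∀ m n (f : ℕ → ℕ → ℤ) →
  sumTo m (λ i → sumTo n (f i)) ≡ sumTo n (λ j → sumTo m (λ i → f i j))
sum-swap zero    n f = sym (sum-zero n λ _ _ → refl)
sum-swap (suc m) n f =
  trans (cong (_+ sumTo n (f m)) (sum-swap m n f)) (sym (sum-+ n _ _))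

sum-suc : ∀ n (f : ℕ → ℤ) → sumTo (suc n) f ≡ f 0 + sumTo n (f ∘ suc)
sum-suc zero    f = ℤ.+-comm 0ℤ (f 0)
sum-suc (suc n) f = trans (cong (_+ f (suc n)) (sum-suc n f)) (ℤ.+-assoc (f 0) _ _)

sum-split : ∀ m n (f : ℕ → ℤ) → sumTo (m ℕ.+ n) f ≡ sumTo m f + sumTo n (λ i → f (m ℕ.+ i))
sum-split m zero    f rewrite ℕ.+-identityʳ m = sym (ℤ.+-identityʳ _)
sum-split m (suc n) f rewrite ℕ.+-suc m n =
  trans (cong (_+ f (m ℕ.+ n)) (sum-split m n f)) (ℤ.+-assoc (sumTo m f) _ _)

-- Defined by Pascal's rule, so that it holds definitionally.
bin : ℕ → ℕ → ℤ
bin n       zero    = 1ℤ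
bin zero    (suc k) = 0ℤ
bin (suc n) (suc k) = bin n k + bin n (suc k)

C≡bin : ∀ n k → + (n C k) ≡ bin n k
C≡bin zero    zero    = refl
C≡bin (suc n) zero    = refl
C≡bin zero    (suc k) = refl
C≡bin (suc n) (suc k) = trans (cong +_ (sym (nCk+nC[k+1]≡[n+1]C[k+1] n k)))
  (cong₂ _+_ (C≡bin n k) (C≡bin n (suc k)))

bin-< : ∀ {n k} → n ℕ.< k → bin n k ≡ 0ℤ
bin-< {zero}  (s≤s _)   = refl
bin-< {suc n} (s≤s n<k) = cong₂ _+_ (bin-< n<k) (bin-< (ℕ.m<n⇒m<1+n n<k))

bin-refl : ∀ n → bin n n ≡ 1ℤ
bin-refl zero    = refl
bin-refl (suc n) = cong₂ _+_ (bin-refl n) (bin-< (ℕ.n<1+n n))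

bin-absorb : ∀ n k → + suc k * bin (suc n) (suc k) ≡ + suc n * bin n k
bin-absorb zero    zero    = refl
bin-absorb zero    (suc k) = ℤ.*-zeroʳ (+ suc (suc k))
bin-absorb (suc n) zero    = trans (ring (bin (suc n) 1)) (trans (cong (λ z → 1ℤ + z) (bin-absorb n zero)) (ring′ (+ suc n)))
  where
  ring : ∀ a → + 1 * (1ℤ + a) ≡ 1ℤ + + 1 * a
  ring = solve-∀
  ring′ : ∀ n → 1ℤ + n * 1ℤ ≡ (1ℤ + n) * 1ℤ
  ring′ = solve-∀
bin-absorb (suc n) (suc k) =
  trans (ring (+ suc k) (bin (suc n) (suc k)) (bin (suc n) (suc (suc k))))
    (trans (cong₂ (λ a b → (a + bin (suc n) (suc k)) + b) (bin-absorb n k) (bin-absorb n (suc k)))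
      (ring′ (+ suc n) (bin n k) (bin n (suc k))))
  where
  ring : ∀ k x y → (1ℤ + k) * (x + y) ≡ (k * x + x) + (1ℤ + k) * y
  ring = solve-∀
  ring′ : ∀ n a b → (n * a + (a + b)) + n * b ≡ (1ℤ + n) * (a + b)
  ring′ = solve-∀

-- Pascal's rule turns `bin-absorb` into the ratio of neighbours in a row. The factor `+ n - + k` is
-- an integer difference: it vanishes at `k = n`, and beyond that both coefficients vanish.
bin-next : ∀ n k → + suc k * bin n (suc k) ≡ (+ n - + k) * bin n k
bin-next n k = trans (ring (+ n) (+ k) (bin n k) (bin n (suc k)))
  (trans (cong (_- (1ℤ + + k) * bin n k) (bin-absorb n k)) (ring′ (+ n) (+ k) (bin n k)))
  where
  ring : ∀ n k x y → (1ℤ + k) * y ≡ (1ℤ + k) * (x + y) - (1ℤ + k) * x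
  ring = solve-∀
  ring′ : ∀ n k x → (1ℤ + n) * x - (1ℤ + k) * x ≡ (n - k) * x
  ring′ = solve-∀

bin-up : ∀ n k → (+ suc n - + k) * bin (suc n) k ≡ + suc n * bin n k
bin-up n zero    = ring (+ n)
  where
  ring : ∀ n → (1ℤ + n - + 0) * 1ℤ ≡ (1ℤ + n) * 1ℤ
  ring = solve-∀
bin-up n (suc k) = trans (ring (+ n) (+ k) (bin n k) (bin n (suc k)))
  (trans (cong (_+ (+ n - + k) * bin n (suc k)) (sym (bin-next n k)))
    (ring′ (+ n) (+ k) (bin n (suc k))))
  where
  ring : ∀ n k x y → (1ℤ + n - (1ℤ + k)) * (x + y) ≡ (n - k) * x + (n - k) * y
  ring = solve-∀
  ring′ : ∀ n k y → (1ℤ + k) * y + (n - k) * y ≡ (1ℤ + n) * y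
  ring′ = solve-∀

bin-up′ : ∀ n k → + suc n * bin (suc n ℕ.+ k) k ≡ + (suc n ℕ.+ k) * bin (n ℕ.+ k) k
bin-up′ n k = trans (cong (_* bin (suc n ℕ.+ k) k) (ring (+ n) (+ k))) (bin-up (n ℕ.+ k) k)
  where
  ring : ∀ n k → 1ℤ + n ≡ 1ℤ + (n + k) - k
  ring = solve-∀

-- Induction on `j`: after multiplication by `suc j`, passing from `j` to `suc j` brings the same
-- factor `n - j` on both sides. Writing the indices as `k + n` and `k + j` keeps truncated
-- subtraction out.
trinomial-revision : ∀ k n j →
  bin (k ℕ.+ n) (k ℕ.+ j) * bin (k ℕ.+ j) k ≡ bin (k ℕ.+ n) k * bin n j
trinomial-revision k n zero rewrite ℕ.+-identityʳ k = cong (bin (k ℕ.+ n) k *_) (bin-refl k)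
trinomial-revision k n (suc j) rewrite ℕ.+-suc k j =
  ℤ.*-cancelˡ-≡ (+ suc j) _ _ (begin
    + suc j * (X′ * Y′)                  ≡⟨ ring₁ (+ suc j) X′ Y′ ⟩
    X′ * (+ suc j * Y′)                  ≡⟨ cong (X′ *_) step ⟩
    X′ * (+ suc (k ℕ.+ j) * Y)           ≡⟨ ring₂ X′ (+ suc (k ℕ.+ j)) Y ⟩
    (+ suc (k ℕ.+ j) * X′) * Y           ≡⟨ cong (_* Y) (bin-next (k ℕ.+ n) (k ℕ.+ j)) ⟩
    (+ (k ℕ.+ n) - + (k ℕ.+ j)) * X * Y  ≡⟨ ring₃ (+ k) (+ n) (+ j) X Y ⟩
    (+ n - + j) * (X * Y)                ≡⟨ cong ((+ n - + j) *_) (trinomial-revision k n j) ⟩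
    (+ n - + j) * (Z * bin n j)          ≡⟨ ring₄ (+ n - + j) Z (bin n j) ⟩
    Z * ((+ n - + j) * bin n j)          ≡⟨ cong (Z *_) (bin-next n j) ⟨
    Z * (+ suc j * bin n (suc j))        ≡⟨ ring₄ Z (+ suc j) (bin n (suc j)) ⟩
    + suc j * (Z * bin n (suc j))        ∎)
  where
  open ≡-Reasoning
  X = bin (k ℕ.+ n) (k ℕ.+ j)
  X′ = bin (k ℕ.+ n) (suc (k ℕ.+ j))
  Y = bin (k ℕ.+ j) k
  Y′ = bin (suc (k ℕ.+ j)) k
  Z = bin (k ℕ.+ n) k
  step : + suc j * Y′ ≡ + suc (k ℕ.+ j) * Y
  step = trans (cong (_* Y′) (r (+ k) (+ j))) (bin-up (k ℕ.+ j) k)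
    where
    r : ∀ k j → 1ℤ + j ≡ 1ℤ + (k + j) - k
    r = solve-∀
  ring₁ : ∀ a b c → a * (b * c) ≡ b * (a * c)
  ring₁ = solve-∀
  ring₂ : ∀ a b c → a * (b * c) ≡ (b * a) * c
  ring₂ = solve-∀
  ring₃ : ∀ k n j X Y → (k + n - (k + j)) * X * Y ≡ (n - j) * (X * Y)
  ring₃ = solve-∀
  ring₄ : ∀ a b c → a * (b * c) ≡ b * (a * c)
  ring₄ = solve-∀

-- The quotient aperySum n x / n

sum-single : ∀ n k (f : ℕ → ℤ) → k ℕ.< n → (∀ i → i ≢ k → f i ≡ 0ℤ) → sumTo n f ≡ f k
sum-single (suc n) k f k<1+n h with ℕ.<-cmp k n
... | tri< k<n _ _  =
  trans (cong₂ _+_ (sum-single n k f k<n h) (h n (ℕ.<⇒≢ k<n ∘ sym))) (ℤ.+-identityʳ (f k))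
... | tri≈ _ refl _ =
  trans (cong (_+ f n) (sum-zero n λ i i<n → h i (ℕ.<⇒≢ i<n))) (ℤ.+-identityˡ (f n))
... | tri> _ _ n<k  = contradiction (ℕ.≤-pred k<1+n) (ℕ.<⇒≱ n<k)

-- u k m = C(m,k) C(m+k,k) is a polynomial of degree k in t = m(m+1):
-- u (k+1) / u k = (t − k(k+1)) / (k+1)².
u : ℕ → ℕ → ℤ
u k m = bin m k * bin (m ℕ.+ k) k

u-suc : ∀ k m → + suc k * + suc k * u (suc k) m ≡ (+ m * + suc m - + k * + suc k) * u k m
u-suc k m rewrite ℕ.+-suc m k = begin
  + suc k * + suc k * (X * Y)                          ≡⟨ ring₁ (+ suc k) X Y ⟩
  (+ suc k * X) * (+ suc k * Y)                        ≡⟨ cong₂ _*_ (bin-next m k) (bin-absorb (m ℕ.+ k) k) ⟩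
  ((+ m - + k) * bin m k) * (+ suc (m ℕ.+ k) * bin (m ℕ.+ k) k) ≡⟨ ring₂ (+ m) (+ k) (bin m k) (bin (m ℕ.+ k) k) ⟩
  (+ m * + suc m - + k * + suc k) * u k m              ∎
  where
  open ≡-Reasoning
  X = bin m (suc k)
  Y = bin (suc (m ℕ.+ k)) (suc k)
  ring₁ : ∀ k X Y → k * k * (X * Y) ≡ (k * X) * (k * Y)
  ring₁ = solve-∀
  ring₂ : ∀ m k x y →
    ((m - k) * x) * ((1ℤ + (m + k)) * y) ≡ (m * (1ℤ + m) - k * (1ℤ + k)) * (x * y)
  ring₂ = solve-∀

u-< : ∀ {k m} → m ℕ.< k → u k m ≡ 0ℤ
u-< {k} {m} m<k = cong (_* bin (m ℕ.+ k) k) (bin-< m<k)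

-- The coefficient of `u l` in the product of `u k` and `u j`. Only `j = k` enters the Apéry
-- polynomials; a separate `j` makes induction on one factor possible.
linCoeff : ℕ → ℕ → ℕ → ℤ
linCoeff k j l = bin (k ℕ.+ j) l * bin l k * bin l j

-- Comparison of coefficients of `u (suc l)`: with t = m(m+1), the product with `u j` is multiplied
-- by t - j(j+1) to reach `u (suc j)`, while t times `u l` is (l+1)² `u (suc l)` + l(l+1) `u l`.
linCoeff-suc : ∀ k j l →
  + suc j * + suc j * linCoeff k (suc j) (suc l) ≡
  + suc l * + suc l * linCoeff k j l +
  (+ suc l * + suc (suc l) - + j * + suc j) * linCoeff k j (suc l)
linCoeff-suc k j l rewrite ℕ.+-suc k j = begin
  + suc j * + suc j * ((X + Y) * V * D₂)
    ≡⟨ ring₁ (+ j) X Y V D₂ ⟩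
  (1ℤ + + j) * (X + Y) * V * (+ suc j * D₂)
    ≡⟨ cong ((1ℤ + + j) * (X + Y) * V *_) (bin-absorb l j) ⟩
  (1ℤ + + j) * (X + Y) * V * (+ suc l * D)
    -- The last bracket is zero by `bin-next`. Adding it separates an `X` part, where `V` can be
    -- lowered to `V′`, from a `Y` part, where `D` can be raised to `D₁`.
    ≡⟨ ring₂ (+ k) (+ j) (+ l) X Y V D ⟩
  (1ℤ + + l) * X * ((+ suc l - + k) * V) * D + (+ 2 + + l + + j) * Y * V * (+ suc l * D)
    + (1ℤ + + l) * V * D * ((+ (k ℕ.+ j) - + l) * X - (1ℤ + + l) * Y)
    ≡⟨ cong₂ (λ a b → a + (1ℤ + + l) * V * D * b)
         (cong₂ (λ a b → (1ℤ + + l) * X * a * D + (+ 2 + + l + + j) * Y * V * b)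
           (bin-up l k) (sym (bin-up l j)))
         (ℤ.i≡j⇒i-j≡0 (sym (bin-next (k ℕ.+ j) l))) ⟩
  (1ℤ + + l) * X * (+ suc l * V′) * D + (+ 2 + + l + + j) * Y * V * ((+ suc l - + j) * D₁)
    + (1ℤ + + l) * V * D * 0ℤ
    ≡⟨ ring₃ (+ j) (+ l) X Y V V′ D D₁ ⟩
  + suc l * + suc l * (X * V′ * D) + (+ suc l * + suc (suc l) - + j * + suc j) * (Y * V * D₁)
    ∎
  where
  open ≡-Reasoning
  X  = bin (k ℕ.+ j) l
  Y  = bin (k ℕ.+ j) (suc l)
  V  = bin (suc l) k
  V′ = bin l k
  D  = bin l j
  D₁ = bin (suc l) j
  D₂ = bin (suc l) (suc j)
  ring₁ : ∀ j X Y V D → (1ℤ + j) * (1ℤ + j) * ((X + Y) * V * D) ≡ (1ℤ + j) * (X + Y) * V * ((1ℤ + j) * D)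
  ring₁ = solve-∀
  ring₂ : ∀ k j l X Y V D → (1ℤ + j) * (X + Y) * V * ((1ℤ + l) * D) ≡
    (1ℤ + l) * X * ((1ℤ + l - k) * V) * D + (+ 2 + l + j) * Y * V * ((1ℤ + l) * D)
    + (1ℤ + l) * V * D * ((k + j - l) * X - (1ℤ + l) * Y)
  ring₂ = solve-∀
  ring₃ : ∀ j l X Y V V′ D D₁ →
    (1ℤ + l) * X * ((1ℤ + l) * V′) * D + (+ 2 + l + j) * Y * V * ((1ℤ + l - j) * D₁)
    + (1ℤ + l) * V * D * 0ℤ ≡
    (1ℤ + l) * (1ℤ + l) * (X * V′ * D) + ((1ℤ + l) * (+ 2 + l) - j * (1ℤ + j)) * (Y * V * D₁)
  ring₃ = solve-∀

-- The same comparison at `u 0`; both sides are zero. The product `0ℤ * 1ℤ` is l(l+1) at l = 0, left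
-- in the shape that `Q 0` has in `u-*-u`.
linCoeff-zero : ∀ k j →
  + suc j * + suc j * linCoeff k (suc j) 0 ≡ (0ℤ * 1ℤ - + j * + suc j) * linCoeff k j 0
linCoeff-zero k zero    = ring (bin 0 k)
  where
  ring : ∀ a → + 1 * + 1 * (1ℤ * a * 0ℤ) ≡ (0ℤ * 1ℤ - 0ℤ * 1ℤ) * (1ℤ * a * 1ℤ)
  ring = solve-∀
linCoeff-zero k (suc j) = ring (bin 0 k) (+ j)
  where
  ring : ∀ a j → (+ 2 + j) * (+ 2 + j) * (1ℤ * a * 0ℤ) ≡
    (0ℤ * 1ℤ - (1ℤ + j) * (+ 2 + j)) * (1ℤ * a * 0ℤ)
  ring = solve-∀

-- Linearization by induction on `j`: multiplying by (j+1)² replaces `u (suc j)` by t - j(j+1) times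
-- `u j`, and the recurrences for `linCoeff` match the resulting coefficients. The range is cut at
-- `n` uniformly in `m ≤ n`, since `u l m` vanishes for `l > m`.
u-*-u : ∀ n k j m → m ℕ.< suc n → k ℕ.< suc n →
  u k m * u j m ≡ sumTo (suc n) (λ l → linCoeff k j l * u l m)
u-*-u n k zero m m≤n k≤n = sym (trans (sum-single (suc n) k f k≤n off) diag)
  where
  f : ℕ → ℤ
  f l = linCoeff k 0 l * u l m
  off : ∀ l → l ≢ k → f l ≡ 0ℤ
  off l l≢k with ℕ.<-cmp l k
  ... | tri< l<k _ _ = trans
    (cong (λ z → bin (k ℕ.+ 0) l * z * 1ℤ * u l m) (bin-< l<k)) (ring (bin (k ℕ.+ 0) l) (u l m))
    where
    ring : ∀ a b → a * 0ℤ * 1ℤ * b ≡ 0ℤ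
    ring = solve-∀
  ... | tri≈ _ l≡k _ = contradiction l≡k l≢k
  ... | tri> _ _ k<l = trans
    (cong (λ z → z * bin l k * 1ℤ * u l m) (bin-< (subst (ℕ._< l) (sym (ℕ.+-identityʳ k)) k<l)))
    (ring (bin l k) (u l m))
    where
    ring : ∀ a b → 0ℤ * a * 1ℤ * b ≡ 0ℤ
    ring = solve-∀
  diag : f k ≡ u k m * u 0 m
  diag rewrite ℕ.+-identityʳ k | bin-refl k = ring (u k m)
    where
    ring : ∀ a → 1ℤ * 1ℤ * 1ℤ * a ≡ a * (1ℤ * 1ℤ)
    ring = solve-∀
u-*-u n k (suc j) m m≤n k≤n = ℤ.*-cancelˡ-≡ (+ suc j * + suc j) _ _ (begin
  s * (u k m * u (suc j) m)
    ≡⟨ ring₁ s (u k m) (u (suc j) m) ⟩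
  u k m * (s * u (suc j) m)
    ≡⟨ cong (u k m *_) (u-suc j m) ⟩
  u k m * ((t - + j * + suc j) * u j m)
    ≡⟨ ring₁ (u k m) (t - + j * + suc j) (u j m) ⟩
  (t - + j * + suc j) * (u k m * u j m)
    ≡⟨ cong ((t - + j * + suc j) *_) (u-*-u n k j m m≤n k≤n) ⟩
  (t - + j * + suc j) * sumTo (suc n) (λ l → linCoeff k j l * u l m)
    ≡⟨ sum-* (suc n) (t - + j * + suc j) (λ l → linCoeff k j l * u l m) ⟨
  sumTo (suc n) (λ l → (t - + j * + suc j) * (linCoeff k j l * u l m))
    ≡⟨ sum-cong (suc n) (λ l _ → term l) ⟩
  sumTo (suc n) (λ l → P l + Q l)
    ≡⟨ sum-+ (suc n) P Q ⟩
  -- `P l` is a multiple of `u (suc l) m`, so it is to be paired with `Q (suc l)`; this leaves `Q 0`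
  -- at the lower end and `P n` at the upper end.
  sumTo n P + P n + sumTo (suc n) Q
    ≡⟨ cong₂ (λ a b → sumTo n P + a + b) Pn≡0 (sum-suc n Q) ⟩
  sumTo n P + 0ℤ + (Q 0 + sumTo n (Q ∘ suc))
    ≡⟨ ring₂ (sumTo n P) (Q 0) (sumTo n (Q ∘ suc)) ⟩
  Q 0 + (sumTo n P + sumTo n (Q ∘ suc))
    ≡⟨ cong (λ z → Q 0 + z) (sum-+ n P (Q ∘ suc)) ⟨
  Q 0 + sumTo n (λ l → P l + Q (suc l))
    ≡⟨ cong₂ _+_ term₀ (sum-cong n (λ l _ → term′ l)) ⟨
  s * R 0 + sumTo n (λ l → s * R (suc l))
    ≡⟨ cong (λ z → s * R 0 + z) (sum-* n s (R ∘ suc)) ⟩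
  s * R 0 + s * sumTo n (R ∘ suc)
    ≡⟨ ℤ.*-distribˡ-+ s (R 0) (sumTo n (R ∘ suc)) ⟨
  s * (R 0 + sumTo n (R ∘ suc))
    ≡⟨ cong (s *_) (sum-suc n R) ⟨
  s * sumTo (suc n) R
    ∎)
  where
  open ≡-Reasoning
  s = + suc j * + suc j
  t = + m * + suc m
  P Q R : ℕ → ℤ
  P l = + suc l * + suc l * linCoeff k j l * u (suc l) m
  Q l = (+ l * + suc l - + j * + suc j) * linCoeff k j l * u l m
  R l = linCoeff k (suc j) l * u l m
  ring₁ : ∀ a b c → a * (b * c) ≡ b * (a * c)
  ring₁ = solve-∀
  ring₂ : ∀ a b c → a + 0ℤ + (b + c) ≡ b + (a + c)
  ring₂ = solve-∀
  -- Here t - j(j+1) is split as (t - l(l+1)) + (l(l+1) - j(j+1)), and the first summand raises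
  -- `u l` to `u (suc l)`.
  term : ∀ l → (t - + j * + suc j) * (linCoeff k j l * u l m) ≡ P l + Q l
  term l = trans (ring₃ t (+ j) (+ l) (linCoeff k j l) (u l m))
    (trans (cong (λ z → linCoeff k j l * z + Q l) (sym (u-suc l m)))
      (ring₄ (+ l) (linCoeff k j l) (u (suc l) m) (Q l)))
    where
    ring₃ : ∀ t j l c v → (t - j * (1ℤ + j)) * (c * v) ≡
      c * ((t - l * (1ℤ + l)) * v) + (l * (1ℤ + l) - j * (1ℤ + j)) * c * v
    ring₃ = solve-∀
    ring₄ : ∀ l c v q → c * ((1ℤ + l) * (1ℤ + l) * v) + q ≡ (1ℤ + l) * (1ℤ + l) * c * v + q
    ring₄ = solve-∀
  Pn≡0 : P n ≡ 0ℤ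
  Pn≡0 = trans (cong (+ suc n * + suc n * linCoeff k j n *_) (u-< m≤n))
    (ℤ.*-zeroʳ (+ suc n * + suc n * linCoeff k j n))
  term₀ : s * R 0 ≡ Q 0
  term₀ = trans (sym (ℤ.*-assoc s (linCoeff k (suc j) 0) (u 0 m)))
    (cong (_* u 0 m) (linCoeff-zero k j))
  term′ : ∀ l → s * R (suc l) ≡ P l + Q (suc l)
  term′ l = trans (sym (ℤ.*-assoc s (linCoeff k (suc j) (suc l)) (u (suc l) m)))
    (trans (cong (_* u (suc l) m) (linCoeff-suc k j l))
      (ℤ.*-distribʳ-+ (u (suc l) m) (+ suc l * + suc l * linCoeff k j l)
        ((+ suc l * + suc (suc l) - + j * + suc j) * linCoeff k j (suc l))))

-- Telescoping: by `bin-up` and `bin-up′` the summand at `suc n` is the difference of the right-hand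
-- sides at `suc n` and `n`. The factor `+ suc n` is the source of the divisibility in part (i).
altSum-u : ∀ n l → sumTo (suc n) (λ m → -1ℤ ^ m * + (2 ℕ.* m ℕ.+ 1) * u l m) ≡
  -1ℤ ^ n * + suc n * (bin n l * bin (suc n ℕ.+ l) l)
altSum-u zero zero = refl
altSum-u zero (suc l) = refl
altSum-u (suc n) l = begin
  sumTo (suc n) (λ m → -1ℤ ^ m * + (2 ℕ.* m ℕ.+ 1) * u l m) + -1ℤ * e * + (2 ℕ.* suc n ℕ.+ 1) * (X * Y)
    ≡⟨ cong₂ (λ a b → a + -1ℤ * e * (b + 1ℤ) * (X * Y)) (altSum-u n l) (ℤ.pos-* 2 (suc n)) ⟩
  e * + suc n * (bin n l * Y) + -1ℤ * e * (+ 2 * + suc n + 1ℤ) * (X * Y)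
    ≡⟨ ring₁ e (+ n) (bin n l) X Y ⟩
  e * Y * (+ suc n * bin n l) - e * (+ 3 + + 2 * + n) * X * Y
    ≡⟨ cong (λ a → e * Y * a - e * (+ 3 + + 2 * + n) * X * Y) (sym (bin-up n l)) ⟩
  e * Y * ((+ suc n - + l) * X) - e * (+ 3 + + 2 * + n) * X * Y
    ≡⟨ ring₂ e (+ n) (+ l) X Y ⟩
  -1ℤ * e * X * (+ (suc (suc n) ℕ.+ l) * Y)
    ≡⟨ cong (-1ℤ * e * X *_) (bin-up′ (suc n) l) ⟨
  -1ℤ * e * X * (+ suc (suc n) * Z)
    ≡⟨ ring₃ e X (+ suc (suc n)) Z ⟩
  -1ℤ * e * + suc (suc n) * (X * Z)
    ∎
  where
  open ≡-Reasoning
  e = -1ℤ ^ n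
  X = bin (suc n) l
  Y = bin (suc n ℕ.+ l) l
  Z = bin (suc (suc n) ℕ.+ l) l
  ring₁ : ∀ e n b X Y → e * (1ℤ + n) * (b * Y) + -1ℤ * e * (+ 2 * (1ℤ + n) + 1ℤ) * (X * Y) ≡
    e * Y * ((1ℤ + n) * b) - e * (+ 3 + + 2 * n) * X * Y
  ring₁ = solve-∀
  ring₂ : ∀ e n l X Y → e * Y * ((1ℤ + n - l) * X) - e * (+ 3 + + 2 * n) * X * Y ≡
    -1ℤ * e * X * ((+ 2 + n + l) * Y)
  ring₂ = solve-∀
  ring₃ : ∀ e X a Z → -1ℤ * e * X * (a * Z) ≡ -1ℤ * e * a * (X * Z)
  ring₃ = solve-∀

-- The coefficient of `u l` in the Apéry polynomial. For `l < n` the cut at `n` loses nothing,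
-- because `linCoeff k k l` vanishes for `k > l`.
aperyCoeff : ℕ → ℤ → ℕ → ℤ
aperyCoeff n x l = sumTo n (λ k → linCoeff k k l * x ^ k)

-- The sum over `k ≤ m` is first padded with zeros up to `n`, so that after linearization the
-- coefficients are the same for all `m ≤ n` and the sum over `m` can be taken inside.
apery-expansion : ∀ n x m → m ℕ.< suc n →
  apery m x ≡ sumTo (suc n) (λ l → aperyCoeff (suc n) x l * u l m)
apery-expansion n x m m≤n = begin
  apery m x
    ≡⟨ sum-cong (suc m) (λ k _ → cong (_* x ^ k) (square k)) ⟩
  sumTo (suc m) f
    ≡⟨ ℤ.+-identityʳ (sumTo (suc m) f) ⟨
  sumTo (suc m) f + 0ℤ
    ≡⟨ cong (λ z → sumTo (suc m) f + z) (sum-zero r λ i _ →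
         cong (λ z → z * u (suc m ℕ.+ i) m * x ^ (suc m ℕ.+ i)) (u-< (ℕ.m≤m+n (suc m) i))) ⟨
  sumTo (suc m) f + sumTo r (λ i → f (suc m ℕ.+ i))
    ≡⟨ sum-split (suc m) r f ⟨
  sumTo (suc m ℕ.+ r) f
    ≡⟨ cong (λ z → sumTo z f) (ℕ.m+[n∸m]≡n m≤n) ⟩
  sumTo (suc n) f
    ≡⟨ sum-cong (suc n) (λ k k≤n → trans (cong (_* x ^ k) (u-*-u n k k m m≤n k≤n))
         (trans (ℤ.*-comm (sumTo (suc n) (λ l → linCoeff k k l * u l m)) (x ^ k))
           (sym (sum-* (suc n) (x ^ k) (λ l → linCoeff k k l * u l m))))) ⟩
  sumTo (suc n) (λ k → sumTo (suc n) (λ l → x ^ k * (linCoeff k k l * u l m)))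
    ≡⟨ sum-swap (suc n) (suc n) (λ k l → x ^ k * (linCoeff k k l * u l m)) ⟩
  sumTo (suc n) (λ l → sumTo (suc n) (λ k → x ^ k * (linCoeff k k l * u l m)))
    ≡⟨ sum-cong (suc n) (λ l _ → trans
         (sum-cong (suc n) (λ k _ → ring (x ^ k) (linCoeff k k l) (u l m)))
         (trans (sum-* (suc n) (u l m) (λ k → linCoeff k k l * x ^ k))
           (ℤ.*-comm (u l m) (aperyCoeff (suc n) x l)))) ⟩
  sumTo (suc n) (λ l → aperyCoeff (suc n) x l * u l m) ∎
  where
  open ≡-Reasoning
  r = suc n ℕ.∸ suc m
  f : ℕ → ℤ
  f k = u k m * u k m * x ^ k
  square : ∀ k → + ((m C k) ℕ.^ 2 ℕ.* ((m ℕ.+ k) C k) ℕ.^ 2) ≡ u k m * u k m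
  square k = begin
    + (a ℕ.^ 2 ℕ.* b ℕ.^ 2)
      ≡⟨ ℤ.pos-* (a ℕ.^ 2) (b ℕ.^ 2) ⟩
    + (a ℕ.^ 2) * + (b ℕ.^ 2)
      ≡⟨ cong₂ (λ v w → + (a ℕ.* v) * + (b ℕ.* w)) (ℕ.*-identityʳ a) (ℕ.*-identityʳ b) ⟩
    + (a ℕ.* a) * + (b ℕ.* b)
      ≡⟨ cong₂ _*_ (ℤ.pos-* a a) (ℤ.pos-* b b) ⟩
    (+ a * + a) * (+ b * + b)
      ≡⟨ cong₂ (λ v w → (v * v) * (w * w)) (C≡bin m k) (C≡bin (m ℕ.+ k) k) ⟩
    (bin m k * bin m k) * (bin (m ℕ.+ k) k * bin (m ℕ.+ k) k)
      ≡⟨ ring′ (bin m k) (bin (m ℕ.+ k) k) ⟩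
    u k m * u k m ∎
    where
    a = m C k
    b = (m ℕ.+ k) C k
    ring′ : ∀ a b → (a * a) * (b * b) ≡ (a * b) * (a * b)
    ring′ = solve-∀
  ring : ∀ a b c → a * (b * c) ≡ c * (b * a)
  ring = solve-∀

-- The index is shifted by one: this is the quotient belonging to `suc n`.
aperyQuotient : ℕ → ℤ → ℤ
aperyQuotient n x =
  -1ℤ ^ n * sumTo (suc n) (λ l → bin n l * bin (suc n ℕ.+ l) l * aperyCoeff (suc n) x l)

aperySum≡ : ∀ n x → aperySum (suc n) x ≡ + suc n * aperyQuotient n x
aperySum≡ n x = begin
  aperySum (suc n) x
    ≡⟨ sum-cong (suc n) (λ m m≤n → trans (cong (w m *_) (apery-expansion n x m m≤n))
         (sym (sum-* (suc n) (w m) (λ l → a l * u l m)))) ⟩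
  sumTo (suc n) (λ m → sumTo (suc n) (λ l → w m * (a l * u l m)))
    ≡⟨ sum-swap (suc n) (suc n) (λ m l → w m * (a l * u l m)) ⟩
  sumTo (suc n) (λ l → sumTo (suc n) (λ m → w m * (a l * u l m)))
    ≡⟨ sum-cong (suc n) (λ l _ → inner l) ⟩
  sumTo (suc n) (λ l → + suc n * -1ℤ ^ n * (b l * a l))
    ≡⟨ sum-* (suc n) (+ suc n * -1ℤ ^ n) (λ l → b l * a l) ⟩
  + suc n * -1ℤ ^ n * sumTo (suc n) (λ l → b l * a l)
    ≡⟨ ℤ.*-assoc (+ suc n) (-1ℤ ^ n) (sumTo (suc n) (λ l → b l * a l)) ⟩
  + suc n * aperyQuotient n x ∎
  where
  open ≡-Reasoning
  w a b : ℕ → ℤ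
  w m = -1ℤ ^ m * + (2 ℕ.* m ℕ.+ 1)
  a = aperyCoeff (suc n) x
  b l = bin n l * bin (suc n ℕ.+ l) l
  inner : ∀ l → sumTo (suc n) (λ m → w m * (a l * u l m)) ≡ + suc n * -1ℤ ^ n * (b l * a l)
  inner l = begin
    sumTo (suc n) (λ m → w m * (a l * u l m))
      ≡⟨ sum-cong (suc n) (λ m _ → ring₁ (w m) (a l) (u l m)) ⟩
    sumTo (suc n) (λ m → a l * (w m * u l m))
      ≡⟨ sum-* (suc n) (a l) (λ m → w m * u l m) ⟩
    a l * sumTo (suc n) (λ m → w m * u l m)
      ≡⟨ cong (a l *_) (altSum-u n l) ⟩
    a l * (-1ℤ ^ n * + suc n * b l)
      ≡⟨ ring₂ (a l) (-1ℤ ^ n) (+ suc n) (b l) ⟩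
    + suc n * -1ℤ ^ n * (b l * a l) ∎
    where
    ring₁ : ∀ a b c → a * (b * c) ≡ b * (a * c)
    ring₁ = solve-∀
    ring₂ : ∀ a e n b → a * (e * n * b) ≡ n * e * (b * a)
    ring₂ = solve-∀

-- Congruences, and the quotient modulo p²

infix 4 _≅_mod_

-- With an explicit quotient and the equation solved for `a`, matching on `refl` eliminates `a`, and
-- the rules for congruences become ring identities.
record _≅_mod_ (a b m : ℤ) : Set where
  constructor congruent
  field
    quotient : ℤ
    equality : a ≡ b + quotient * m

module _ {m : ℤ} where

  ≅-reflexive : ∀ {a b} → a ≡ b → a ≅ b mod m
  ≅-reflexive {a} refl = congruent 0ℤ (sym (ℤ.+-identityʳ a))

  ≅-refl : ∀ {a} → a ≅ a mod m
  ≅-refl = ≅-reflexive refl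

  ≅-sym : ∀ {a b} → a ≅ b mod m → b ≅ a mod m
  ≅-sym {b = b} (congruent q refl) = congruent (- q) (ring b q m)
    where
    ring : ∀ b q m → b ≡ b + q * m + - q * m
    ring = solve-∀

  ≅-trans : ∀ {a b c} → a ≅ b mod m → b ≅ c mod m → a ≅ c mod m
  ≅-trans {c = c} (congruent q refl) (congruent r refl) = congruent (r + q) (ring c q r m)
    where
    ring : ∀ c q r m → c + r * m + q * m ≡ c + (r + q) * m
    ring = solve-∀

  ≅-+ : ∀ {a b c d} → a ≅ b mod m → c ≅ d mod m → a + c ≅ b + d mod m
  ≅-+ {b = b} {d = d} (congruent q refl) (congruent r refl) = congruent (q + r) (ring b d q r m)
    where
    ring : ∀ b d q r m → b + q * m + (d + r * m) ≡ b + d + (q + r) * m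
    ring = solve-∀

  ≅-* : ∀ {a b c d} → a ≅ b mod m → c ≅ d mod m → a * c ≅ b * d mod m
  ≅-* {b = b} {d = d} (congruent q refl) (congruent r refl) =
    congruent (q * d + (b + q * m) * r) (ring b d q r m)
    where
    ring : ∀ b d q r m → (b + q * m) * (d + r * m) ≡ b * d + (q * d + (b + q * m) * r) * m
    ring = solve-∀

  ≅-*ˡ : ∀ c {a b} → a ≅ b mod m → c * a ≅ c * b mod m
  ≅-*ˡ c = ≅-* (≅-refl {a = c})

  ≅-*ʳ : ∀ c {a b} → a ≅ b mod m → a * c ≅ b * c mod m
  ≅-*ʳ c h = ≅-* h (≅-refl {a = c})

  ≅-minus : ∀ {a b c d} → a ≅ b mod m → c ≅ d mod m → a - c ≅ b - d mod m
  ≅-minus {b = b} {d = d} (congruent q refl) (congruent r refl) = congruent (q - r) (ring b d q r m)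
    where
    ring : ∀ b d q r m → b + q * m - (d + r * m) ≡ b - d + (q - r) * m
    ring = solve-∀

  ≅-sum : ∀ n {f g : ℕ → ℤ} → (∀ i → i ℕ.< n → f i ≅ g i mod m) → sumTo n f ≅ sumTo n g mod m
  ≅-sum zero    h = ≅-refl
  ≅-sum (suc n) h = ≅-+ (≅-sum n λ i i<n → h i (ℕ.m<n⇒m<1+n i<n)) (h n ℕ.≤-refl)

  ≅-^ : ∀ n {a b} → a ≅ b mod m → a ^ n ≅ b ^ n mod m
  ≅-^ zero    h = ≅-refl
  ≅-^ (suc n) h = ≅-* h (≅-^ n h)

  multiple≅0 : ∀ q → q * m ≅ 0ℤ mod m
  multiple≅0 q = congruent q (sym (ℤ.+-identityˡ (q * m)))

  ≅⇒-≅0 : ∀ {a b} → a ≅ b mod m → a - b ≅ 0ℤ mod m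
  ≅⇒-≅0 {b = b} h = ≅-trans (≅-minus h (≅-refl {a = b})) (≅-reflexive (ℤ.+-inverseʳ b))

  -≅0⇒≅ : ∀ {a b} → a - b ≅ 0ℤ mod m → a ≅ b mod m
  -≅0⇒≅ {a} {b} h =
    ≅-trans (≅-reflexive (ring a b)) (≅-trans (≅-+ h (≅-refl {a = b})) (≅-reflexive (ℤ.+-identityˡ b)))
    where
    ring : ∀ a b → a ≡ a - b + b
    ring = solve-∀

≅-setoid : ℤ → Setoid 0ℓ 0ℓ
≅-setoid m = record
  { Carrier = ℤ
  ; _≈_ = λ a b → a ≅ b mod m
  ; isEquivalence = record { refl = ≅-refl ; sym = ≅-sym ; trans = ≅-trans }
  }

module ≅-Reasoning (m : ℤ) = SetoidReasoning (≅-setoid m)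

-- If a = qm and b - c = rn, then a(b - c) = qr·mn. This is how two congruences modulo p combine to
-- one modulo p².
≅0-*-lift : ∀ {m n a b c} → a ≅ 0ℤ mod m → b ≅ c mod n → a * b ≅ a * c mod (m * n)
≅0-*-lift {m} {n} {c = c} (congruent q refl) (congruent r refl) = congruent (q * r) (ring c q r m n)
  where
  ring : ∀ c q r m n → (0ℤ + q * m) * (c + r * n) ≡ (0ℤ + q * m) * c + q * r * (m * n)
  ring = solve-∀

≅-weaken : ∀ {m} n {a b} → a ≅ b mod (m * n) → a ≅ b mod n
≅-weaken {m} n {b = b} (congruent q refl) = congruent (q * m) (cong (λ z → b + z) (sym (ℤ.*-assoc q m n)))

-- Cancellation modulo p and p², and binomial coefficients divisible by p

≅0⇒∣ : ∀ {n a} → a ≅ 0ℤ mod (+ n) → n ℕ.∣ ∣ a ∣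
≅0⇒∣ {n} (congruent q refl) = ℕ.divides ∣ q ∣
  (trans (cong ∣_∣ (ℤ.+-identityˡ (q * + n))) (ℤ.abs-* q (+ n)))

∣⇒≅0 : ∀ {n a} → n ℕ.∣ ∣ a ∣ → a ≅ 0ℤ mod (+ n)
∣⇒≅0 {n} {a} n∣a with Signed.∣ᵤ⇒∣ {+ n} {a} n∣a
... | Signed.divides q refl = multiple≅0 q

<⇒≇0 : ∀ {p k} → suc k ℕ.< p → ¬ (+ suc k ≅ 0ℤ mod (+ p))
<⇒≇0 k<p h = ℕ.<⇒≱ k<p (ℕ.∣⇒≤ (≅0⇒∣ h))

prime-cancel : ∀ {p} → Prime p → ∀ a {b} → ¬ (a ≅ 0ℤ mod (+ p)) →
  a * b ≅ 0ℤ mod (+ p) → b ≅ 0ℤ mod (+ p)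
prime-cancel {p} pp a {b} p∤a h
  with euclidsLemma ∣ a ∣ ∣ b ∣ pp (subst (p ℕ.∣_) (ℤ.abs-* a b) (≅0⇒∣ h))
... | inj₁ p∣a = contradiction (∣⇒≅0 p∣a) p∤a
... | inj₂ p∣b = ∣⇒≅0 p∣b

-- Euclid's lemma is used twice: it gives b = qp, and after one factor p is removed from the
-- equation it gives p ∣ q.
prime²-cancel : ∀ {p} → Prime p → ∀ a {b} → ¬ (a ≅ 0ℤ mod (+ p)) →
  a * b ≅ 0ℤ mod (+ p * + p) → b ≅ 0ℤ mod (+ p * + p)
prime²-cancel {p} pp a p∤a h with prime-cancel pp a p∤a (≅-weaken {+ p} (+ p) h) | h
... | congruent q refl | congruent r e = lift (prime-cancel pp a p∤a
    (congruent r (ℤ.*-cancelʳ-≡ (a * q) (0ℤ + r * + p) (+ p) (trans (ring₁ a q (+ p)) (trans e (ring₂ r (+ p)))))))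
  where
  instance _ = prime⇒nonZero pp
  ring₁ : ∀ a q p → a * q * p ≡ a * (0ℤ + q * p)
  ring₁ = solve-∀
  ring₂ : ∀ r p → 0ℤ + r * (p * p) ≡ (0ℤ + r * p) * p
  ring₂ = solve-∀
  lift : q ≅ 0ℤ mod (+ p) → 0ℤ + q * + p ≅ 0ℤ mod (+ p * + p)
  lift (congruent t refl) = congruent t (ring₃ t (+ p))
    where
    ring₃ : ∀ t p → 0ℤ + (0ℤ + t * p) * p ≡ 0ℤ + t * (p * p)
    ring₃ = solve-∀

-- Pascal's rule lowers `i`; at `i = 0` the identity k C(p,k) = p C(p-1,k-1) applies, with k prime
-- to p.
prime∣bin : ∀ {p} → Prime p → ∀ {i k} → i ℕ.< k → k ℕ.< p → bin (p ℕ.+ i) k ≅ 0ℤ mod (+ p)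
prime∣bin {suc n} pp {zero} {suc k} _ k<p rewrite ℕ.+-identityʳ n =
  prime-cancel pp (+ suc k) (<⇒≇0 k<p)
    (≅-trans (≅-reflexive (trans (bin-absorb n k) (ℤ.*-comm (+ suc n) (bin n k))))
      (multiple≅0 (bin n k)))
prime∣bin {p} pp {suc i} {suc k} (s≤s i<k) k<p rewrite ℕ.+-suc p i =
  ≅-+ (prime∣bin pp i<k (ℕ.<-trans (ℕ.n<1+n k) k<p)) (prime∣bin pp (ℕ.m<n⇒m<1+n i<k) k<p)

-- (l+1)² b(l+1) = (p² − (l+1)²) b(l) for b(l) = C(p−1,l) C(p+l,l).
bin*bin≅±1 : ∀ {n} → Prime (suc n) → ∀ l → l ℕ.< suc n →
  bin n l * bin (suc n ℕ.+ l) l ≅ -1ℤ ^ l mod (+ suc n * + suc n)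
bin*bin≅±1 {n} pp zero    _   = ≅-refl
bin*bin≅±1 {n} pp (suc l) l<n = begin
  b′                            ≡⟨ ring₀ b′ b ⟩
  (b′ + b) - b                  ≈⟨ ≅-minus cancelled (bin*bin≅±1 pp l (ℕ.<-trans (ℕ.n<1+n l) l<n)) ⟩
  0ℤ - -1ℤ ^ l                  ≡⟨ ring₁ (-1ℤ ^ l) ⟩
  -1ℤ ^ suc l                   ∎
  where
  open ≅-Reasoning (+ suc n * + suc n)
  b  = bin n l * bin (suc n ℕ.+ l) l
  b′ = bin n (suc l) * bin (suc n ℕ.+ suc l) (suc l)
  ring₀ : ∀ x y → x ≡ (x + y) - y
  ring₀ = solve-∀
  ring₁ : ∀ e → 0ℤ - e ≡ -1ℤ * e
  ring₁ = solve-∀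
  ring₂ : ∀ s X Y Z → s * (s * (X * Y + Z)) ≡ (s * X) * (s * Y) + s * s * Z
  ring₂ = solve-∀
  ring₃ : ∀ n l x y →
    ((n - l) * x) * ((1ℤ + (1ℤ + n + l)) * y) + (1ℤ + l) * (1ℤ + l) * (x * y) ≡
    x * y * ((1ℤ + n) * (1ℤ + n))
  ring₃ = solve-∀
  recurrence : + suc l * (+ suc l * (b′ + b)) ≡ b * (+ suc n * + suc n)
  recurrence rewrite ℕ.+-suc n l = trans (ring₂ (+ suc l) (bin n (suc l)) (bin (suc (suc n ℕ.+ l)) (suc l)) b)
    (trans (cong₂ (λ v w → v * w + + suc l * + suc l * b) (bin-next n l) (bin-absorb (suc n ℕ.+ l) l))
      (ring₃ (+ n) (+ l) (bin n l) (bin (suc n ℕ.+ l) l)))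
  cancelled : b′ + b ≅ 0ℤ mod (+ suc n * + suc n)
  cancelled = prime²-cancel pp (+ suc l) (<⇒≇0 l<n) (prime²-cancel pp (+ suc l) (<⇒≇0 l<n)
    (≅-trans (≅-reflexive recurrence) (multiple≅0 b)))

-- The alternating sum of the linearization coefficients

-1^n*-1^n≡1 : ∀ n → -1ℤ ^ n * -1ℤ ^ n ≡ 1ℤ
-1^n*-1^n≡1 zero    = refl
-1^n*-1^n≡1 (suc n) = trans (ring (-1ℤ ^ n)) (-1^n*-1^n≡1 n)
  where
  ring : ∀ e → (-1ℤ * e) * (-1ℤ * e) ≡ e * e
  ring = solve-∀

-- The a-th finite difference of j ↦ C(b+j, c+a).
altSum-bin : ∀ M a b c → a ℕ.< M →
  sumTo M (λ j → -1ℤ ^ j * bin a j * bin (b ℕ.+ j) (c ℕ.+ a)) ≡ -1ℤ ^ a * bin b c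
altSum-bin M zero b c a<M = trans (sum-single M 0 f a<M off) diag
  where
  f : ℕ → ℤ
  f j = -1ℤ ^ j * bin 0 j * bin (b ℕ.+ j) (c ℕ.+ 0)
  off : ∀ i → i ≢ 0 → f i ≡ 0ℤ
  off zero    i≢0 = contradiction refl i≢0
  off (suc i) _   = cong (_* bin (b ℕ.+ suc i) (c ℕ.+ 0)) (ℤ.*-zeroʳ (-1ℤ ^ suc i))
  diag : f 0 ≡ 1ℤ * bin b c
  diag rewrite ℕ.+-identityʳ b | ℕ.+-identityʳ c = refl
altSum-bin (suc M) (suc a) b c (s≤s a<M) rewrite ℕ.+-suc c a = begin
  sumTo (suc M) (λ j → -1ℤ ^ j * bin (suc a) j * g j)
    ≡⟨ sum-suc M (λ j → -1ℤ ^ j * bin (suc a) j * g j) ⟩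
  F 0 + sumTo M (λ j → -1ℤ * -1ℤ ^ j * (bin a j + bin a (suc j)) * g (suc j))
    ≡⟨ cong (λ z → F 0 + z) (trans (sum-cong M λ j _ → ring₁ (-1ℤ ^ j) (bin a j) (bin a (suc j)) (g (suc j)))
         (sum-+ M G (F ∘ suc))) ⟩
  F 0 + (sumTo M G + sumTo M (F ∘ suc))
    ≡⟨ ring₂ (F 0) (sumTo M G) (sumTo M (F ∘ suc)) ⟩
  sumTo M G + (F 0 + sumTo M (F ∘ suc))
    ≡⟨ cong (λ z → sumTo M G + z) (sum-suc M F) ⟨
  sumTo M G + (sumTo M F + F M)
    ≡⟨ cong (λ z → sumTo M G + (sumTo M F + z)) FM≡0 ⟩
  sumTo M G + (sumTo M F + 0ℤ)
    ≡⟨ cong (λ z → sumTo M G + z) (ℤ.+-identityʳ (sumTo M F)) ⟩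
  sumTo M G + sumTo M F
    ≡⟨ sum-+ M G F ⟨
  sumTo M (λ j → G j + F j)
    ≡⟨ sum-cong M (λ j _ → difference j) ⟩
  sumTo M (λ j → -1ℤ * (-1ℤ ^ j * bin a j * bin (b ℕ.+ j) (c ℕ.+ a)))
    ≡⟨ sum-* M -1ℤ (λ j → -1ℤ ^ j * bin a j * bin (b ℕ.+ j) (c ℕ.+ a)) ⟩
  -1ℤ * sumTo M (λ j → -1ℤ ^ j * bin a j * bin (b ℕ.+ j) (c ℕ.+ a))
    ≡⟨ cong (-1ℤ *_) (altSum-bin M a b c a<M) ⟩
  -1ℤ * (-1ℤ ^ a * bin b c)
    ≡⟨ ℤ.*-assoc -1ℤ (-1ℤ ^ a) (bin b c) ⟨
  -1ℤ * -1ℤ ^ a * bin b c ∎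
  where
  open ≡-Reasoning
  g F G : ℕ → ℤ
  g j = bin (b ℕ.+ j) (suc (c ℕ.+ a))
  F j = -1ℤ ^ j * bin a j * g j
  G j = -1ℤ * -1ℤ ^ j * bin a j * g (suc j)
  FM≡0 : F M ≡ 0ℤ
  FM≡0 = trans (cong (λ z → -1ℤ ^ M * z * g M) (bin-< a<M))
    (cong (_* g M) (ℤ.*-zeroʳ (-1ℤ ^ M)))
  ring₁ : ∀ e x y z → -1ℤ * e * (x + y) * z ≡ -1ℤ * e * x * z + -1ℤ * e * y * z
  ring₁ = solve-∀
  ring₂ : ∀ x y z → x + (y + z) ≡ y + (x + z)
  ring₂ = solve-∀
  ring₃ : ∀ e x v w → -1ℤ * e * x * (v + w) + e * x * w ≡ -1ℤ * (e * x * v)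
  ring₃ = solve-∀
  difference : ∀ j → G j + F j ≡ -1ℤ * (-1ℤ ^ j * bin a j * bin (b ℕ.+ j) (c ℕ.+ a))
  difference j rewrite ℕ.+-suc b j =
    ring₃ (-1ℤ ^ j) (bin a j) (bin (b ℕ.+ j) (c ℕ.+ a)) (bin (b ℕ.+ j) (suc (c ℕ.+ a)))

-- Terms with `l < k` vanish. For `l = k + i`, trinomial revision extracts C(2k,k) and leaves the
-- k-th finite difference of C(k+i,k), which is a sign cancelling `-1ℤ ^ k`. The hypothesis on `M`
-- makes the range reach `l = 2k`.
altSum-linCoeff : ∀ k M → k ℕ.< M →
  sumTo (k ℕ.+ M) (λ l → -1ℤ ^ l * linCoeff k k l) ≡ bin (k ℕ.+ k) k
altSum-linCoeff k M k<M = begin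
  sumTo (k ℕ.+ M) f
    ≡⟨ sum-split k M f ⟩
  sumTo k f + sumTo M (λ i → f (k ℕ.+ i))
    ≡⟨ cong₂ _+_ (sum-zero k low) (sum-cong M λ i _ → high i) ⟩
  0ℤ + sumTo M (λ i → e * c * h i)
    ≡⟨ ℤ.+-identityˡ (sumTo M (λ i → e * c * h i)) ⟩
  sumTo M (λ i → e * c * h i)
    ≡⟨ sum-* M (e * c) h ⟩
  e * c * sumTo M h
    ≡⟨ cong (e * c *_) (altSum-bin M k k 0 k<M) ⟩
  e * c * (e * 1ℤ)
    ≡⟨ ring₁ e c ⟩
  e * e * c
    ≡⟨ cong (_* c) (-1^n*-1^n≡1 k) ⟩
  1ℤ * c
    ≡⟨ ℤ.*-identityˡ c ⟩
  c ∎
  where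
  open ≡-Reasoning
  e = -1ℤ ^ k
  c = bin (k ℕ.+ k) k
  f h : ℕ → ℤ
  f l = -1ℤ ^ l * linCoeff k k l
  h i = -1ℤ ^ i * bin k i * bin (k ℕ.+ i) k
  ring₁ : ∀ e c → e * c * (e * 1ℤ) ≡ e * e * c
  ring₁ = solve-∀
  ring₂ : ∀ e x → e * (x * 0ℤ * 0ℤ) ≡ 0ℤ
  ring₂ = solve-∀
  ring₃ : ∀ e d c v w → e * d * (c * v * w) ≡ e * c * (d * v * w)
  ring₃ = solve-∀
  low : ∀ l → l ℕ.< k → f l ≡ 0ℤ
  low l l<k = trans (cong (λ z → -1ℤ ^ l * (bin (k ℕ.+ k) l * z * z)) (bin-< l<k))
    (ring₂ (-1ℤ ^ l) (bin (k ℕ.+ k) l))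
  high : ∀ i → f (k ℕ.+ i) ≡ e * c * h i
  high i = trans (cong₂ (λ v w → v * (w * bin (k ℕ.+ i) k))
      (ℤ.^-distribˡ-+-* -1ℤ k i) (trinomial-revision k k i))
    (ring₃ e (-1ℤ ^ i) c (bin k i) (bin (k ℕ.+ i) k))

-- The full sum is taken with `M = p`; the terms from `p` to `p + k - 1` contain the square of
-- C(p+i,k) with i < k, hence p².
altSum-linCoeff≅ : ∀ {p} → Prime p → ∀ k → k ℕ.< p →
  sumTo p (λ l → -1ℤ ^ l * linCoeff k k l) ≅ bin (k ℕ.+ k) k mod (+ p * + p)
altSum-linCoeff≅ {p} pp k k<p = ≅-sym (begin
  bin (k ℕ.+ k) k
    ≡⟨ altSum-linCoeff k p k<p ⟨
  sumTo (k ℕ.+ p) f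
    ≡⟨ cong (λ z → sumTo z f) (ℕ.+-comm k p) ⟩
  sumTo (p ℕ.+ k) f
    ≡⟨ sum-split p k f ⟩
  sumTo p f + sumTo k (λ i → f (p ℕ.+ i))
    ≈⟨ ≅-+ (≅-refl {a = sumTo p f}) (≅-sum k tail) ⟩
  sumTo p f + sumTo k (λ _ → 0ℤ)
    ≡⟨ cong (λ z → sumTo p f + z) (sum-zero k λ _ _ → refl) ⟩
  sumTo p f + 0ℤ
    ≡⟨ ℤ.+-identityʳ (sumTo p f) ⟩
  sumTo p f ∎)
  where
  open ≅-Reasoning (+ p * + p)
  f : ℕ → ℤ
  f l = -1ℤ ^ l * linCoeff k k l
  ring₁ : ∀ e x y → e * (x * y * y) ≡ e * x * (y * y)
  ring₁ = solve-∀
  ring₂ : ∀ e x y → e * x * (y * 0ℤ) ≡ 0ℤ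
  ring₂ = solve-∀
  tail : ∀ i → i ℕ.< k → f (p ℕ.+ i) ≅ 0ℤ mod (+ p * + p)
  tail i i<k = ≅-trans (≅-reflexive (ring₁ e x y)) (≅-trans
    (≅-*ˡ (e * x) (≅0-*-lift y≅0 y≅0)) (≅-reflexive (ring₂ e x y)))
    where
    e = -1ℤ ^ (p ℕ.+ i)
    x = bin (k ℕ.+ k) (p ℕ.+ i)
    y = bin (p ℕ.+ i) k
    y≅0 = prime∣bin pp i<k k<p

-- The products C(p-1,l) C(p+l,l) become signs, and exchanging the sums leaves one alternating sum
-- of `linCoeff k k` for each `k`. The sign hypothesis expresses that `suc n` is odd.
aperyQuotient≅ : ∀ {n} → Prime (suc n) → -1ℤ ^ n ≡ 1ℤ → ∀ x →
  aperyQuotient n x ≅ sumTo (suc n) (λ k → bin (k ℕ.+ k) k * x ^ k) mod (+ suc n * + suc n)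
aperyQuotient≅ {n} pp even x = begin
  -1ℤ ^ n * sumTo p (λ l → bin n l * bin (p ℕ.+ l) l * aperyCoeff p x l)
    ≈⟨ ≅-* (≅-reflexive even) (≅-sum p λ l l<p → ≅-*ʳ (aperyCoeff p x l) (bin*bin≅±1 pp l l<p)) ⟩
  1ℤ * sumTo p (λ l → -1ℤ ^ l * aperyCoeff p x l)
    ≡⟨ ℤ.*-identityˡ (sumTo p (λ l → -1ℤ ^ l * aperyCoeff p x l)) ⟩
  sumTo p (λ l → -1ℤ ^ l * aperyCoeff p x l)
    ≡⟨ sum-cong p (λ l _ → sum-* p (-1ℤ ^ l) (λ k → linCoeff k k l * x ^ k)) ⟨
  sumTo p (λ l → sumTo p (λ k → -1ℤ ^ l * (linCoeff k k l * x ^ k)))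
    ≡⟨ sum-swap p p (λ l k → -1ℤ ^ l * (linCoeff k k l * x ^ k)) ⟩
  sumTo p (λ k → sumTo p (λ l → -1ℤ ^ l * (linCoeff k k l * x ^ k)))
    ≡⟨ sum-cong p (λ k _ → trans (sum-cong p λ l _ → ring (-1ℤ ^ l) (linCoeff k k l) (x ^ k))
         (sum-* p (x ^ k) (λ l → -1ℤ ^ l * linCoeff k k l))) ⟩
  sumTo p (λ k → x ^ k * sumTo p (λ l → -1ℤ ^ l * linCoeff k k l))
    ≈⟨ ≅-sum p (λ k k<p → ≅-*ˡ (x ^ k) (altSum-linCoeff≅ pp k k<p)) ⟩
  sumTo p (λ k → x ^ k * bin (k ℕ.+ k) k)
    ≡⟨ sum-cong p (λ k _ → ℤ.*-comm (x ^ k) (bin (k ℕ.+ k) k)) ⟩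
  sumTo p (λ k → bin (k ℕ.+ k) k * x ^ k) ∎
  where
  open ≅-Reasoning (+ suc n * + suc n)
  p = suc n
  ring : ∀ e c y → e * (c * y) ≡ y * (e * c)
  ring = solve-∀

-- Part (ii): Euler's criterion

-- The bound `M` is independent of `h` because the sums later run up to p while the exponent is
-- (p-1)/2; terms beyond `h` are zero.
binomial-theorem : ∀ M h y → h ℕ.< M → sumTo M (λ k → bin h k * y ^ k) ≡ (1ℤ + y) ^ h
binomial-theorem M zero y h<M = sum-single M 0 (λ k → bin 0 k * y ^ k) h<M off
  where
  off : ∀ i → i ≢ 0 → bin 0 i * y ^ i ≡ 0ℤ
  off zero    i≢0 = contradiction refl i≢0
  off (suc i) _   = refl
binomial-theorem (suc M) (suc h) y (s≤s h<M) = begin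
  sumTo (suc M) (λ k → bin (suc h) k * y ^ k)
    ≡⟨ sum-suc M (λ k → bin (suc h) k * y ^ k) ⟩
  1ℤ + sumTo M (λ k → (bin h k + bin h (suc k)) * (y * y ^ k))
    ≡⟨ cong (λ z → 1ℤ + z) (trans (sum-cong M λ k _ → ring₁ (bin h k) (bin h (suc k)) y (y ^ k))
         (trans (sum-+ M (λ k → y * f k) (f ∘ suc)) (cong (_+ sumTo M (f ∘ suc)) (sum-* M y f)))) ⟩
  1ℤ + (y * sumTo M f + sumTo M (f ∘ suc))
    ≡⟨ ring₂ (y * sumTo M f) (sumTo M (f ∘ suc)) ⟩
  y * sumTo M f + (1ℤ + sumTo M (f ∘ suc))
    ≡⟨ cong₂ _+_ (cong (y *_) (binomial-theorem M h y h<M))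
         (trans (sym (sum-suc M f)) (binomial-theorem (suc M) h y (ℕ.m<n⇒m<1+n h<M))) ⟩
  y * (1ℤ + y) ^ h + (1ℤ + y) ^ h
    ≡⟨ ring₃ y ((1ℤ + y) ^ h) ⟩
  (1ℤ + y) ^ suc h ∎
  where
  open ≡-Reasoning
  f : ℕ → ℤ
  f k = bin h k * y ^ k
  ring₁ : ∀ a b y z → (a + b) * (y * z) ≡ y * (a * z) + b * (y * z)
  ring₁ = solve-∀
  ring₂ : ∀ a b → 1ℤ + (a + b) ≡ a + (1ℤ + b)
  ring₂ = solve-∀
  ring₃ : ∀ y z → y * z + z ≡ (1ℤ + y) * z
  ring₃ = solve-∀

prime∣bin₀ : ∀ {p} → Prime p → ∀ k → suc k ℕ.< p → bin p (suc k) ≅ 0ℤ mod (+ p)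
prime∣bin₀ {p} pp k k<p =
  subst (λ z → bin z (suc k) ≅ 0ℤ mod (+ p)) (ℕ.+-identityʳ p) (prime∣bin pp {0} (s≤s z≤n) k<p)

freshman : ∀ {n} → Prime (suc n) → ∀ y → (1ℤ + y) ^ suc n ≅ 1ℤ + y ^ suc n mod (+ suc n)
freshman {n} pp y = begin
  (1ℤ + y) ^ p
    ≡⟨ binomial-theorem (suc p) p y (ℕ.n<1+n p) ⟨
  sumTo p f + bin p p * y ^ p
    ≡⟨ cong₂ _+_ (sum-suc n f) (trans (cong (_* y ^ p) (bin-refl p)) (ℤ.*-identityˡ (y ^ p))) ⟩
  1ℤ + sumTo n (f ∘ suc) + y ^ p
    ≈⟨ ≅-+ (≅-+ (≅-refl {a = 1ℤ}) (≅-sum n λ k k<n → ≅-*ʳ (y ^ suc k) (prime∣bin₀ pp k (s≤s k<n))))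
         (≅-refl {a = y ^ p}) ⟩
  1ℤ + sumTo n (λ k → 0ℤ * y ^ suc k) + y ^ p
    ≡⟨ cong (λ z → 1ℤ + z + y ^ p) (sum-zero n λ _ _ → refl) ⟩
  1ℤ + y ^ p ∎
  where
  open ≅-Reasoning (+ suc n)
  p = suc n
  f : ℕ → ℤ
  f k = bin p k * y ^ k

fermat′ : ∀ {n} → Prime (suc n) → ∀ r → (+ r) ^ suc n ≅ + r mod (+ suc n)
fermat′ pp zero    = ≅-refl
fermat′ pp (suc r) = ≅-trans (freshman pp (+ r)) (≅-+ (≅-refl {a = 1ℤ}) (fermat′ pp r))

fermat : ∀ {n} → Prime (suc n) → ∀ r → ¬ (+ r ≅ 0ℤ mod (+ suc n)) → (+ r) ^ n ≅ 1ℤ mod (+ suc n)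
fermat {n} pp r r≇0 = -≅0⇒≅ (prime-cancel pp (+ r) r≇0
  (≅-trans (≅-reflexive (ring (+ r) ((+ r) ^ n))) (≅⇒-≅0 (fermat′ pp r))))
  where
  ring : ∀ r s → r * (s - 1ℤ) ≡ r * s - r
  ring = solve-∀

-- Central binomial coefficients modulo p

central-suc : ∀ k →
  + suc k * bin (suc k ℕ.+ suc k) (suc k) ≡ + 2 * (1ℤ + + 2 * + k) * bin (k ℕ.+ k) k
central-suc k rewrite ℕ.+-suc k k = begin
  + suc k * bin (suc (suc (k ℕ.+ k))) (suc k)
    ≡⟨ bin-absorb (suc (k ℕ.+ k)) k ⟩
  + suc (suc (k ℕ.+ k)) * Z
    ≡⟨ ring₁ (+ k) Z ⟩
  + 2 * ((+ suc (k ℕ.+ k) - + k) * Z)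
    ≡⟨ cong (+ 2 *_) (bin-up (k ℕ.+ k) k) ⟩
  + 2 * (+ suc (k ℕ.+ k) * bin (k ℕ.+ k) k)
    ≡⟨ ring₂ (+ k) (bin (k ℕ.+ k) k) ⟩
  + 2 * (1ℤ + + 2 * + k) * bin (k ℕ.+ k) k ∎
  where
  open ≡-Reasoning
  Z = bin (suc (k ℕ.+ k)) k
  ring₁ : ∀ k Z → (+ 2 + (k + k)) * Z ≡ + 2 * ((1ℤ + (k + k) - k) * Z)
  ring₁ = solve-∀
  ring₂ : ∀ k c → + 2 * ((1ℤ + (k + k)) * c) ≡ + 2 * (1ℤ + + 2 * k) * c
  ring₂ = solve-∀

-- Both sides have the same ratio of consecutive terms modulo p = 2h + 1, as 2(2k+1) + 4(h-k) = 2p;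
-- the denominator k + 1 is prime to p.
central≅ : ∀ h → Prime (suc (h ℕ.+ h)) → ∀ k → k ℕ.< suc (h ℕ.+ h) →
  bin (k ℕ.+ k) k ≅ (- + 4) ^ k * bin h k mod (+ suc (h ℕ.+ h))
central≅ h pp zero    _   = ≅-refl
central≅ h pp (suc k) k<p = -≅0⇒≅ (prime-cancel pp (+ suc k) (<⇒≇0 k<p) (begin
  + suc k * (bin (suc k ℕ.+ suc k) (suc k) - (- + 4) * q * bin h (suc k))
    ≡⟨ ring₁ (+ suc k) (bin (suc k ℕ.+ suc k) (suc k)) q (bin h (suc k)) ⟩
  + suc k * bin (suc k ℕ.+ suc k) (suc k) + + 4 * q * (+ suc k * bin h (suc k))
    ≡⟨ cong₂ (λ a b → a + + 4 * q * b) (central-suc k) (bin-next h k) ⟩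
  + 2 * (1ℤ + + 2 * + k) * bin (k ℕ.+ k) k + + 4 * q * ((+ h - + k) * bin h k)
    ≈⟨ ≅-+ (≅-*ˡ (+ 2 * (1ℤ + + 2 * + k)) (central≅ h pp k (ℕ.<-trans (ℕ.n<1+n k) k<p)))
         (≅-refl {a = + 4 * q * ((+ h - + k) * bin h k)}) ⟩
  + 2 * (1ℤ + + 2 * + k) * (q * bin h k) + + 4 * q * ((+ h - + k) * bin h k)
    ≡⟨ ring₂ (+ k) (+ h) q (bin h k) ⟩
  + 2 * q * bin h k * + suc (h ℕ.+ h)
    ≈⟨ multiple≅0 (+ 2 * q * bin h k) ⟩
  0ℤ ∎))
  where
  open ≅-Reasoning (+ suc (h ℕ.+ h))
  q = (- + 4) ^ k
  ring₁ : ∀ s x q y → s * (x - (- + 4) * q * y) ≡ s * x + + 4 * q * (s * y)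
  ring₁ = solve-∀
  ring₂ : ∀ k h q b → + 2 * (1ℤ + + 2 * k) * (q * b) + + 4 * q * ((h - k) * b) ≡
    + 2 * q * b * (1ℤ + (h + h))
  ring₂ = solve-∀

^-distrib-* : ∀ a b n → (a * b) ^ n ≡ a ^ n * b ^ n
^-distrib-* a b zero    = refl
^-distrib-* a b (suc n) = trans (cong (a * b *_) (^-distrib-* a b n)) (ring a b (a ^ n) (b ^ n))
  where
  ring : ∀ a b c d → a * b * (c * d) ≡ a * c * (b * d)
  ring = solve-∀

centralSum≅ : ∀ h → Prime (suc (h ℕ.+ h)) → ∀ x →
  sumTo (suc (h ℕ.+ h)) (λ k → bin (k ℕ.+ k) k * x ^ k) ≅ (+ 1 - + 4 * x) ^ h mod (+ suc (h ℕ.+ h))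
centralSum≅ h pp x = begin
  sumTo p (λ k → bin (k ℕ.+ k) k * x ^ k)
    ≈⟨ ≅-sum p (λ k k<p → ≅-*ʳ (x ^ k) (central≅ h pp k k<p)) ⟩
  sumTo p (λ k → (- + 4) ^ k * bin h k * x ^ k)
    ≡⟨ sum-cong p (λ k _ → trans (ring₁ ((- + 4) ^ k) (bin h k) (x ^ k))
         (cong (bin h k *_) (sym (^-distrib-* (- + 4) x k)))) ⟩
  sumTo p (λ k → bin h k * (- + 4 * x) ^ k)
    ≡⟨ binomial-theorem p h (- + 4 * x) (s≤s (ℕ.m≤m+n h h)) ⟩
  (1ℤ + - + 4 * x) ^ h
    ≡⟨ cong (_^ h) (ring₂ x) ⟩
  (+ 1 - + 4 * x) ^ h ∎
  where
  open ≅-Reasoning (+ suc (h ℕ.+ h))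
  p = suc (h ℕ.+ h)
  ring₁ : ∀ q b y → q * b * y ≡ b * (q * y)
  ring₁ = solve-∀
  ring₂ : ∀ x → 1ℤ + - + 4 * x ≡ 1ℤ - + 4 * x
  ring₂ = solve-∀

-- Polynomials, given by coefficients from the constant term up, and their roots modulo p

eval : ∀ {n} → Vec ℤ n → ℤ → ℤ
eval []       x = 0ℤ
eval (c ∷ cs) x = c + x * eval cs x

-- Synthetic division by X - r: the coefficients of the quotient are the Horner values of the tails,
-- and the remainder is `eval cs r`.
quot : ∀ {n} → ℤ → Vec ℤ (suc n) → Vec ℤ n
quot r (c ∷ [])         = []
quot r (c ∷ cs@(_ ∷ _)) = eval cs r ∷ quot r cs

eval-quot : ∀ {n} r (cs : Vec ℤ (suc n)) x → eval cs x ≡ eval cs r + (x - r) * eval (quot r cs) x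
eval-quot r (c ∷ []) x = ring c x r
  where
  ring : ∀ c x r → c + x * 0ℤ ≡ c + r * 0ℤ + (x - r) * 0ℤ
  ring = solve-∀
eval-quot r (c ∷ cs@(_ ∷ _)) x =
  trans (cong (λ z → c + x * z) (eval-quot r cs x)) (ring c x r (eval cs r) (eval (quot r cs) x))
  where
  ring : ∀ c x r e q → c + x * (e + (x - r) * q) ≡ c + r * e + (x - r) * (e + x * q)
  ring = solve-∀

-- Lagrange's bound: a vector of length `n` has degree below `n`, so `n` distinct roots force it to
-- vanish. After division by X - `r 0` the other roots pass to the quotient, because
-- `r (suc i) - r 0` can be cancelled.
roots⇒eval≅0 : ∀ {p} → Prime p → ∀ {n} (cs : Vec ℤ n) (r : ℕ → ℤ) →
  (∀ i j → i ℕ.< j → j ℕ.< n → ¬ (r j ≅ r i mod (+ p))) →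
  (∀ i → i ℕ.< n → eval cs (r i) ≅ 0ℤ mod (+ p)) →
  ∀ x → eval cs x ≅ 0ℤ mod (+ p)
roots⇒eval≅0 pp {zero}  []  r distinct root x = ≅-refl
roots⇒eval≅0 {p} pp {suc n} cs  r distinct root x = begin
  eval cs x                                         ≡⟨ eval-quot (r 0) cs x ⟩
  eval cs (r 0) + (x - r 0) * eval (quot (r 0) cs) x
    ≈⟨ ≅-+ (root 0 (s≤s z≤n)) (≅-*ˡ (x - r 0) (roots⇒eval≅0 pp (quot (r 0) cs) (r ∘ suc)
         (λ i j i<j j<n → distinct (suc i) (suc j) (s≤s i<j) (s≤s j<n)) root′ x)) ⟩
  0ℤ + (x - r 0) * 0ℤ                               ≡⟨ ring (x - r 0) ⟩
  0ℤ                                                ∎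
  where
  open ≅-Reasoning (+ p)
  ring : ∀ a → 0ℤ + a * 0ℤ ≡ 0ℤ
  ring = solve-∀
  ring′ : ∀ e d → d ≡ (e + d) - e
  ring′ = solve-∀
  root′ : ∀ i → i ℕ.< n → eval (quot (r 0) cs) (r (suc i)) ≅ 0ℤ mod (+ p)
  root′ i i<n = prime-cancel pp (r (suc i) - r 0)
    (λ h → distinct 0 (suc i) (s≤s z≤n) (s≤s i<n) (-≅0⇒≅ h)) (begin
      d                                     ≡⟨ ring′ (eval cs (r 0)) d ⟩
      (eval cs (r 0) + d) - eval cs (r 0)   ≡⟨ cong (_- eval cs (r 0)) (eval-quot (r 0) cs (r (suc i))) ⟨
      eval cs (r (suc i)) - eval cs (r 0)   ≈⟨ ≅-minus (root (suc i) (s≤s i<n)) (root 0 (s≤s z≤n)) ⟩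
      0ℤ                                    ∎)
    where
    d = (r (suc i) - r 0) * eval (quot (r 0) cs) (r (suc i))

monomial : ∀ n → Vec ℤ (suc n)
monomial zero    = 1ℤ ∷ []
monomial (suc n) = 0ℤ ∷ monomial n

eval-monomial : ∀ n x → eval (monomial n) x ≡ x ^ n
eval-monomial zero    x = cong (λ z → 1ℤ + z) (ℤ.*-zeroʳ x)
eval-monomial (suc n) x = trans (ℤ.+-identityˡ (x * eval (monomial n) x)) (cong (x *_) (eval-monomial n x))

<⇒≇ : ∀ {p r s} → r ℕ.< s → s ℕ.< p → ¬ (+ s ≅ + r mod (+ p))
<⇒≇ {p} {r} r<s s<p h with ℕ.m≤n⇒∃[o]m+o≡n r<s
... | d , refl = <⇒≇0 (ℕ.≤-<-trans (s≤s (ℕ.m≤n+m d r)) s<p)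
  (≅-trans (≅-reflexive (ring (+ r) (+ d))) (≅⇒-≅0 h))
  where
  ring : ∀ r d → 1ℤ + d ≡ (1ℤ + (r + d)) - r
  ring = solve-∀

<-≅⇒≡ : ∀ {p r s} → r ℕ.< p → s ℕ.< p → + r ≅ + s mod (+ p) → r ≡ s
<-≅⇒≡ {r = r} {s} r<p s<p h with ℕ.<-cmp r s
... | tri< r<s _ _ = contradiction (≅-sym h) (<⇒≇ r<s s<p)
... | tri≈ _ r≡s _ = r≡s
... | tri> _ _ s<r = contradiction h (<⇒≇ s<r r<p)

≅-%ℕ : ∀ a p .{{_ : NonZero p}} → a ≅ + (a %ℕ p) mod (+ p)
≅-%ℕ a p = congruent (a /ℕ p) (a≡a%ℕn+[a/ℕn]*n a p)

≅-% : ∀ m p .{{_ : NonZero p}} → + m ≅ + (m ℕ.% p) mod (+ p)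
≅-% m p = congruent (+ (m ℕ./ p)) (trans (cong +_ (ℕ.m≡m%n+[m/n]*n m p))
  (cong (λ z → + (m ℕ.% p) + z) (ℤ.pos-* (m ℕ./ p) p)))

-- Euler's criterion for an odd prime p, with (p-1)/2 written as `suc h`

module _ (h : ℕ) (pp : Prime (suc (suc h ℕ.+ suc h))) where

  private
    p = suc (suc h ℕ.+ suc h)

  residue : ∀ a y → ¬ (a ≅ 0ℤ mod (+ p)) → a ≅ + y * + y mod (+ p) → a ^ suc h ≅ 1ℤ mod (+ p)
  residue a y a≇0 a≅y² = begin
    a ^ suc h                     ≈⟨ ≅-^ (suc h) a≅y² ⟩
    (+ y * + y) ^ suc h           ≡⟨ ^-distrib-* (+ y) (+ y) (suc h) ⟩
    (+ y) ^ suc h * (+ y) ^ suc h ≡⟨ ℤ.^-distribˡ-+-* (+ y) (suc h) (suc h) ⟨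
    (+ y) ^ (suc h ℕ.+ suc h)     ≈⟨ fermat pp y (λ y≅0 → a≇0 (≅-trans a≅y² (≅-* y≅0 y≅0))) ⟩
    1ℤ                            ∎
    where open ≅-Reasoning (+ p)

  -- If a^((p−1)/2) ≡ 1, then X^((p−1)/2) − 1 has the (p+1)/2 roots a, 1², 2², …, ((p−1)/2)².
  nonresidue≇1 : ∀ a → ¬ (a ≅ 0ℤ mod (+ p)) →
    (∀ y → y ℕ.< p → ¬ (+ y * + y ≅ a mod (+ p))) → ¬ (a ^ suc h ≅ 1ℤ mod (+ p))
  -- The polynomial would vanish everywhere modulo p, but its value at 0 is -1.
  nonresidue≇1 a a≇0 nonsquare a^≅1 = <⇒≇0 {k = 0} (s≤s (s≤s z≤n))
    (≅-minus (≅-refl {a = 0ℤ}) (roots⇒eval≅0 pp cs r distinct root 0ℤ))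
    where
    cs : Vec ℤ (suc (suc h))
    cs = -1ℤ ∷ monomial h
    r : ℕ → ℤ
    r zero    = a
    r (suc i) = + suc i * + suc i
    small : ∀ {i} → i ℕ.< suc (suc h) → i ℕ.< p
    small i≤h = ℕ.<-≤-trans i≤h (s≤s (ℕ.m≤m+n (suc h) (suc h)))
    distinct : ∀ i j → i ℕ.< j → j ℕ.< suc (suc h) → ¬ (r j ≅ r i mod (+ p))
    distinct zero    (suc j) _ j≤h e = nonsquare (suc j) (small j≤h) e
    -- The difference of the two squares factors into difference and sum of the bases, both strictly
    -- between 0 and p.
    distinct (suc i) (suc j) (s≤s i<j) (s≤s j≤h) e = <⇒≇0 {k = i ℕ.+ suc j} sum<p
      (prime-cancel pp (+ suc j - + suc i) (λ d → <⇒≇ (s≤s i<j) (small (s≤s j≤h)) (-≅0⇒≅ d))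
        (≅-trans (≅-reflexive (ring (+ i) (+ j))) (≅⇒-≅0 e)))
      where
      sum<p : suc (i ℕ.+ suc j) ℕ.< p
      sum<p = s≤s (ℕ.+-mono-≤ (ℕ.≤-trans i<j (ℕ.<⇒≤ j≤h)) j≤h)
      ring : ∀ i j → (1ℤ + j - (1ℤ + i)) * (1ℤ + (i + (1ℤ + j))) ≡ (1ℤ + j) * (1ℤ + j) - (1ℤ + i) * (1ℤ + i)
      ring = solve-∀
    eval-cs : ∀ x → eval cs x ≡ x ^ suc h - 1ℤ
    eval-cs x = trans (cong (λ z → -1ℤ + x * z) (eval-monomial h x)) (ℤ.+-comm -1ℤ (x ^ suc h))
    root : ∀ i → i ℕ.< suc (suc h) → eval cs (r i) ≅ 0ℤ mod (+ p)
    root zero    _   = ≅-trans (≅-reflexive (eval-cs a)) (≅⇒-≅0 a^≅1)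
    root (suc i) i≤h = ≅-trans (≅-reflexive (eval-cs (r (suc i)))) (≅⇒-≅0
      (residue (r (suc i)) (suc i) (λ e → <⇒≇0 (small i≤h) (prime-cancel pp (+ suc i) (<⇒≇0 (small i≤h)) e))
        ≅-refl))

  -- By Fermat p divides (e - 1)(e + 1) for e = a^((p-1)/2), and the first factor is excluded by
  -- `nonresidue≇1`. Since `fermat` speaks of natural numbers, `a` is replaced by its remainder.
  nonresidue : ∀ a → ¬ (a ≅ 0ℤ mod (+ p)) →
    (∀ y → y ℕ.< p → ¬ (+ y * + y ≅ a mod (+ p))) → a ^ suc h ≅ -1ℤ mod (+ p)
  nonresidue a a≇0 nonsquare = -≅0⇒≅ (prime-cancel pp (a ^ suc h - 1ℤ)
    (λ e → nonresidue≇1 a a≇0 nonsquare (-≅0⇒≅ e)) (begin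
      (e - 1ℤ) * (e - -1ℤ)                ≡⟨ ring e ⟩
      e * e - 1ℤ                          ≡⟨ cong (_- 1ℤ) (ℤ.^-distribˡ-+-* a (suc h) (suc h)) ⟨
      a ^ (suc h ℕ.+ suc h) - 1ℤ          ≈⟨ ≅-minus (≅-^ (suc h ℕ.+ suc h) (≅-%ℕ a p)) (≅-refl {a = 1ℤ}) ⟩
      (+ r) ^ (suc h ℕ.+ suc h) - 1ℤ        ≈⟨ ≅⇒-≅0 (fermat pp r λ r≅0 → a≇0 (≅-trans (≅-%ℕ a p) r≅0)) ⟩
      0ℤ                                  ∎))
    where
    open ≅-Reasoning (+ p)
    e = a ^ suc h
    r = a %ℕ p
    ring : ∀ e → (e - 1ℤ) * (e - -1ℤ) ≡ e * e - 1ℤ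
    ring = solve-∀

  -- The case distinctions repeat those in `legendre`, so that its value computes in each branch.
  euler-criterion : ∀ a → a ^ suc h ≅ legendre a p mod (+ p)
  euler-criterion a with a %ℕ p in eq
  ... | zero  = ≅-^ (suc h) a≅0
    where
    a≅0 : a ≅ 0ℤ mod (+ p)
    a≅0 = subst (λ z → a ≅ + z mod (+ p)) eq (≅-%ℕ a p)
  ... | suc r with any (λ y → (y ℕ.* y) ℕ.% p ℕ.≡ᵇ suc r) (upTo p) in found
  ...   | true  = square (satisfied (any⁻ test (upTo p) (subst T (sym found) tt)))
    where
    test : ℕ → Bool
    test y = (y ℕ.* y) ℕ.% p ℕ.≡ᵇ suc r
    a≅r : a ≅ + suc r mod (+ p)
    a≅r = subst (λ z → a ≅ + z mod (+ p)) eq (≅-%ℕ a p)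
    square : ∃ (λ y → T (test y)) → a ^ suc h ≅ 1ℤ mod (+ p)
    square (y , t) = residue a y
      (λ a≅0 → <⇒≇0 (subst (ℕ._< p) eq (n%ℕd<d a p)) (≅-trans (≅-sym a≅r) a≅0))
      (≅-trans a≅r (≅-trans
        (≅-reflexive (cong +_ (sym (ℕ.≡ᵇ⇒≡ ((y ℕ.* y) ℕ.% p) (suc r) t))))
        (≅-trans (≅-sym (≅-% (y ℕ.* y) p)) (≅-reflexive (ℤ.pos-* y y)))))
  ...   | false = nonresidue a
      (λ a≅0 → <⇒≇0 r<p (≅-trans (≅-sym a≅r) a≅0))
      (λ y y<p y²≅a → subst T found (any⁺ test (lose (∈-upTo⁺ y<p) (ℕ.≡⇒≡ᵇ ((y ℕ.* y) ℕ.% p) (suc r)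
        (<-≅⇒≡ (ℕ.m%n<n (y ℕ.* y) p) r<p (≅-trans (≅-sym (≅-% (y ℕ.* y) p))
          (≅-trans (≅-reflexive (ℤ.pos-* y y)) (≅-trans y²≅a a≅r))))))))
    where
    test : ℕ → Bool
    test y = (y ℕ.* y) ℕ.% p ℕ.≡ᵇ suc r
    r<p : suc r ℕ.< p
    r<p = subst (ℕ._< p) eq (n%ℕd<d a p)
    a≅r : a ≅ + suc r mod (+ p)
    a≅r = subst (λ z → a ≅ + z mod (+ p)) eq (≅-%ℕ a p)

-- Part (iii): Lucas sequences

-- conv x g n m is the coefficient of T^m in (1 + x T)^n Σ g(i) T^i.
conv : ℤ → (ℕ → ℤ) → ℕ → ℕ → ℤ
conv x g zero    m       = g m
conv x g (suc n) zero    = conv x g n zero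
conv x g (suc n) (suc m) = conv x g n (suc m) + x * conv x g n m

conv-sum : ∀ x g n m → conv x g n m ≡ sumTo (suc m) (λ k → bin n k * x ^ k * g (m ℕ.∸ k))
conv-sum x g zero m = sym (trans (sum-single (suc m) 0 f (s≤s z≤n) off) (ℤ.*-identityˡ (g m)))
  where
  f : ℕ → ℤ
  f k = bin 0 k * x ^ k * g (m ℕ.∸ k)
  off : ∀ i → i ≢ 0 → f i ≡ 0ℤ
  off zero    i≢0 = contradiction refl i≢0
  off (suc i) _   = refl
conv-sum x g (suc n) zero    = conv-sum x g n zero
conv-sum x g (suc n) (suc m) = begin
  conv x g n (suc m) + x * conv x g n m
    ≡⟨ cong₂ (λ a b → a + x * b) (conv-sum x g n (suc m)) (conv-sum x g n m) ⟩
  sumTo (suc (suc m)) F + x * sumTo (suc m) G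
    ≡⟨ cong₂ _+_ (sum-suc (suc m) F) (sym (sum-* (suc m) x G)) ⟩
  F 0 + sumTo (suc m) (F ∘ suc) + sumTo (suc m) (λ k → x * G k)
    ≡⟨ ℤ.+-assoc (F 0) (sumTo (suc m) (F ∘ suc)) (sumTo (suc m) (λ k → x * G k)) ⟩
  F 0 + (sumTo (suc m) (F ∘ suc) + sumTo (suc m) (λ k → x * G k))
    ≡⟨ cong (λ z → F 0 + z) (trans (sym (sum-+ (suc m) (F ∘ suc) (λ k → x * G k)))
         (sum-cong (suc m) λ k _ → ring (bin n k) (bin n (suc k)) x (x ^ k) (g (m ℕ.∸ k)))) ⟩
  H 0 + sumTo (suc m) (H ∘ suc)
    ≡⟨ sum-suc (suc m) H ⟨
  sumTo (suc (suc m)) H ∎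
  where
  open ≡-Reasoning
  F G H : ℕ → ℤ
  F k = bin n k * x ^ k * g (suc m ℕ.∸ k)
  G k = bin n k * x ^ k * g (m ℕ.∸ k)
  H k = bin (suc n) k * x ^ k * g (suc m ℕ.∸ k)
  ring : ∀ a b x y z → b * (x * y) * z + x * (a * y * z) ≡ (a + b) * (x * y) * z
  ring = solve-∀

conv-conv : ∀ x g a b m → conv x (conv x g a) b m ≡ conv x g (b ℕ.+ a) m
conv-conv x g a zero    m       = refl
conv-conv x g a (suc b) zero    = conv-conv x g a b zero
conv-conv x g a (suc b) (suc m) =
  cong₂ (λ v w → v + x * w) (conv-conv x g a b (suc m)) (conv-conv x g a b m)

-- Modulo p, the factor (1 + xT)^p is 1 in all degrees below p.
conv-prime≅ : ∀ {p} → Prime p → ∀ x g m → m ℕ.< p → conv x g p m ≅ g m mod (+ p)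
conv-prime≅ {p} pp x g m m<p = begin
  conv x g p m
    ≡⟨ conv-sum x g p m ⟩
  sumTo (suc m) F
    ≡⟨ sum-suc m F ⟩
  1ℤ * g m + sumTo m (F ∘ suc)
    ≈⟨ ≅-+ (≅-reflexive (ℤ.*-identityˡ (g m))) (≅-sum m λ k k<m → ≅-*ʳ (g (m ℕ.∸ suc k))
         (≅-*ʳ (x ^ suc k) (prime∣bin₀ pp k (ℕ.≤-<-trans k<m m<p)))) ⟩
  g m + sumTo m (λ k → 0ℤ * x ^ suc k * g (m ℕ.∸ suc k))
    ≡⟨ cong (λ z → g m + z) (sum-zero m λ _ _ → refl) ⟩
  g m + 0ℤ
    ≡⟨ ℤ.+-identityʳ (g m) ⟩
  g m ∎
  where
  open ≅-Reasoning (+ p)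
  F : ℕ → ℤ
  F k = bin p k * x ^ k * g (m ℕ.∸ k)

-- The two extreme terms are split off, the last being zero by `g 0 ≡ 0ℤ`. When `suc n` is prime, it
-- divides every binomial coefficient that remains in the sum.
conv-diagonal : ∀ x n g → g 0 ≡ 0ℤ →
  conv x g (suc n) (suc n) ≡ g (suc n) + sumTo n (λ k → bin (suc n) (suc k) * x ^ suc k * g (n ℕ.∸ k))
conv-diagonal x n g g0≡0 = begin
  conv x g (suc n) (suc n)
    ≡⟨ conv-sum x g (suc n) (suc n) ⟩
  sumTo (suc n) F + F (suc n)
    ≡⟨ cong₂ _+_ (sum-suc n F) last ⟩
  1ℤ * g (suc n) + sumTo n (F ∘ suc) + 0ℤ
    ≡⟨ ring (g (suc n)) (sumTo n (F ∘ suc)) ⟩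
  g (suc n) + sumTo n (F ∘ suc) ∎
  where
  open ≡-Reasoning
  F : ℕ → ℤ
  F k = bin (suc n) k * x ^ k * g (suc n ℕ.∸ k)
  ring : ∀ a b → 1ℤ * a + b + 0ℤ ≡ a + b
  ring = solve-∀
  last : F (suc n) ≡ 0ℤ
  last = trans (cong (bin (suc n) (suc n) * x ^ suc n *_) (trans (cong g (ℕ.n∸n≡0 n)) g0≡0))
    (ℤ.*-zeroʳ (bin (suc n) (suc n) * x ^ suc n))

-- Applying (1 + x T)^p twice: the middle coefficients are divisible by p, so that
-- they may be multiplied with a congruence modulo p.
conv-2prime≅ : ∀ {p} → Prime p → ∀ x g → g 0 ≡ 0ℤ →
  conv x g (p ℕ.+ p) p ≅ + 2 * conv x g p p - g p mod (+ p * + p)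
conv-2prime≅ {suc n} pp x g g0≡0 = begin
  conv x g (p ℕ.+ p) p
    ≡⟨ conv-conv x g p p p ⟨
  conv x c p p
    ≡⟨ conv-diagonal x n c (trans (conv-0 p) g0≡0) ⟩
  c p + sumTo n (λ k → bin p (suc k) * x ^ suc k * c (n ℕ.∸ k))
    ≈⟨ ≅-+ (≅-refl {a = c p}) (≅-sum n λ k k<n → ≅0-*-lift
         (≅-*ʳ (x ^ suc k) (prime∣bin₀ pp k (s≤s k<n)))
         (conv-prime≅ pp x g (n ℕ.∸ k) (s≤s (ℕ.m∸n≤m n k)))) ⟩
  c p + S
    ≡⟨ ring (c p) (g p) S ⟩
  c p + (g p + S) - g p
    ≡⟨ cong (λ z → c p + z - g p) (conv-diagonal x n g g0≡0) ⟨
  c p + c p - g p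
    ≡⟨ ring′ (c p) (g p) ⟩
  + 2 * c p - g p ∎
  where
  open ≅-Reasoning (+ suc n * + suc n)
  p = suc n
  c : ℕ → ℤ
  c = conv x g p
  S = sumTo n (λ k → bin p (suc k) * x ^ suc k * g (n ℕ.∸ k))
  ring : ∀ a b s → a + s ≡ a + (b + s) - b
  ring = solve-∀
  ring′ : ∀ a b → a + a - b ≡ + 2 * a - b
  ring′ = solve-∀
  conv-0 : ∀ a → conv x g a 0 ≡ g 0
  conv-0 zero    = refl
  conv-0 (suc a) = conv-0 a

lucasU : ℤ → ℤ → ℕ → ℤ
lucasU P Q zero          = 0ℤ
lucasU P Q (suc zero)    = 1ℤ
lucasU P Q (suc (suc n)) = P * lucasU P Q (suc n) - Q * lucasU P Q n

module _ (x : ℤ) where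

  private
    -- The parameters are chosen so that the denominator of the generating function is (1 + xT)² -
    -- T; hence (1 + xT)² W = T W + T.
    W : ℕ → ℤ
    W = lucasU (+ 1 - + 2 * x) (x * x)

    c : ℕ → ℕ → ℤ
    c = conv x W

  c-0 : ∀ n → c n 0 ≡ 0ℤ
  c-0 zero    = refl
  c-0 (suc n) = c-0 n

  c-1 : ∀ n → c n 1 ≡ 1ℤ
  c-1 zero    = refl
  c-1 (suc n) = trans (cong₂ (λ a b → a + x * b) (c-1 n) (c-0 n)) (cong (λ z → 1ℤ + z) (ℤ.*-zeroʳ x))

  -- Σ W(m) T^m = T / (1 − (1−2x) T + x² T²)
  c-rec : ∀ n m → c n (suc (suc m)) ≡
    (+ 1 - + 2 * x) * c n (suc m) - x * x * c n m + bin n (suc m) * x ^ suc m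
  c-rec zero    m = sym (ℤ.+-identityʳ (W (suc (suc m))))
  c-rec (suc n) zero = begin
    c n 2 + x * c n 1
      ≡⟨ cong (_+ x * c n 1) (c-rec n 0) ⟩
    (+ 1 - + 2 * x) * c n 1 - x * x * c n 0 + bin n 1 * (x * 1ℤ) + x * c n 1
      ≡⟨ cong₂ (λ a b → (+ 1 - + 2 * x) * a - x * x * b + bin n 1 * (x * 1ℤ) + x * a) (c-1 n) (c-0 n) ⟩
    (+ 1 - + 2 * x) * 1ℤ - x * x * 0ℤ + bin n 1 * (x * 1ℤ) + x * 1ℤ
      ≡⟨ ring x (bin n 1) ⟩
    (+ 1 - + 2 * x) * (1ℤ + x * 0ℤ) - x * x * 0ℤ + (1ℤ + bin n 1) * (x * 1ℤ)
      ≡⟨ cong₂ (λ a b → (+ 1 - + 2 * x) * (a + x * b) - x * x * b + (1ℤ + bin n 1) * (x * 1ℤ)) (c-1 n) (c-0 n) ⟨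
    (+ 1 - + 2 * x) * (c n 1 + x * c n 0) - x * x * c n 0 + (1ℤ + bin n 1) * (x * 1ℤ) ∎
    where
    open ≡-Reasoning
    ring : ∀ x b → (+ 1 - + 2 * x) * 1ℤ - x * x * 0ℤ + b * (x * 1ℤ) + x * 1ℤ ≡
      (+ 1 - + 2 * x) * (1ℤ + x * 0ℤ) - x * x * 0ℤ + (1ℤ + b) * (x * 1ℤ)
    ring = solve-∀
  c-rec (suc n) (suc m) =
    trans (cong₂ (λ a b → a + x * b) (c-rec n (suc m)) (c-rec n m))
      (ring x (c n (suc (suc m))) (c n (suc m)) (c n m) (bin n (suc m)) (bin n (suc (suc m))) (x ^ suc m))
    where
    ring : ∀ x c₂ c₁ c₀ b b′ y →
      (+ 1 - + 2 * x) * c₂ - x * x * c₁ + b′ * (x * y) +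
        x * ((+ 1 - + 2 * x) * c₁ - x * x * c₀ + b * y) ≡
      (+ 1 - + 2 * x) * (c₂ + x * c₁) - x * x * (c₁ + x * c₀) + (b + b′) * (x * y)
    ring = solve-∀

  -- Multiplying (1 + xT)² W = T W + T by (1 + xT)^(2n) and comparing coefficients of T^(n+1) gives
  -- the two summands.
  c-central : ∀ n → c (suc n ℕ.+ suc n) (suc n) ≡ c (n ℕ.+ n) n + bin (n ℕ.+ n) n * x ^ n
  c-central zero    = c-1 2
  c-central (suc n) rewrite ℕ.+-suc n (suc n) = begin
    c N (suc (suc n)) + x * c N (suc n) + x * (c N (suc n) + x * c N n)
      ≡⟨ cong (λ z → z + x * c N (suc n) + x * (c N (suc n) + x * c N n)) (c-rec N n) ⟩
    (+ 1 - + 2 * x) * c N (suc n) - x * x * c N n + b + x * c N (suc n) + x * (c N (suc n) + x * c N n)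
      ≡⟨ ring x (c N (suc n)) (c N n) b ⟩
    c N (suc n) + b ∎
    where
    open ≡-Reasoning
    N = suc n ℕ.+ suc n
    b = bin N (suc n) * x ^ suc n
    ring : ∀ x c₁ c₀ b →
      (+ 1 - + 2 * x) * c₁ - x * x * c₀ + b + x * c₁ + x * (c₁ + x * c₀) ≡ c₁ + b
    ring = solve-∀

  centralSum≡ : ∀ n → sumTo n (λ k → bin (k ℕ.+ k) k * x ^ k) ≡ c (n ℕ.+ n) n
  centralSum≡ zero    = refl
  centralSum≡ (suc n) =
    trans (cong (_+ bin (n ℕ.+ n) n * x ^ n) (centralSum≡ n)) (sym (c-central n))

  -- The relation for W, multiplied by (1 + xT)^n, gives `c n (suc n)` for the next diagonal entry
  -- but one, since C(n,n+1) = 0. This equals `c (suc n) (suc n) - x * c n n`, the Lucas recurrence.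
  c-diagonal : ∀ n → c n n ≡ lucasU (+ 1) x n
  c-diagonal zero          = refl
  c-diagonal (suc zero)    = c-1 1
  c-diagonal (suc (suc n)) = begin
    c n (suc (suc n)) + x * c n (suc n) + x * (c n (suc n) + x * c n n)
      ≡⟨ cong (λ z → z + x * c n (suc n) + x * (c n (suc n) + x * c n n)) (trans (c-rec n n)
           (cong (λ z → (+ 1 - + 2 * x) * c n (suc n) - x * x * c n n + z * x ^ suc n) (bin-< (ℕ.n<1+n n)))) ⟩
    (+ 1 - + 2 * x) * c n (suc n) - x * x * c n n + 0ℤ * x ^ suc n + x * c n (suc n) + x * (c n (suc n) + x * c n n)
      ≡⟨ ring x (c n (suc n)) (c n n) (x ^ suc n) ⟩
    + 1 * (c n (suc n) + x * c n n) - x * c n n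
      ≡⟨ cong₂ (λ a b → + 1 * a - x * b) (c-diagonal (suc n)) (c-diagonal n) ⟩
    + 1 * lucasU (+ 1) x (suc n) - x * lucasU (+ 1) x n ∎
    where
    open ≡-Reasoning
    ring : ∀ x c₁ c₀ y →
      (+ 1 - + 2 * x) * c₁ - x * x * c₀ + 0ℤ * y + x * c₁ + x * (c₁ + x * c₀) ≡
      + 1 * (c₁ + x * c₀) - x * c₀
    ring = solve-∀

  centralSum≅lucas : ∀ {p} → Prime p → sumTo p (λ k → bin (k ℕ.+ k) k * x ^ k) ≅
    + 2 * lucasU (+ 1) x p - lucasU (+ 1 - + 2 * x) (x * x) p mod (+ p * + p)
  centralSum≅lucas {p} pp = ≅-trans (≅-reflexive (centralSum≡ p))
    (≅-trans (conv-2prime≅ pp x W refl)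
      (≅-reflexive (cong (λ z → + 2 * z - W p) (c-diagonal p))))

-- The first sequence changes sign after 3 steps and the second has period 3, so the left side has
-- period 6 and only n = 1 and n = 5 need to be evaluated.
lucas-legendre3 : ∀ n → ¬ 2 ℕ.∣ n → ¬ 3 ℕ.∣ n →
  + 2 * lucasU (+ 1) (+ 1) n - lucasU (- + 1) (+ 1) n ≡ legendre3 n
lucas-legendre3 0 2∤n _ = contradiction (2 ℕ.∣0) 2∤n
lucas-legendre3 1 _ _   = refl
lucas-legendre3 2 2∤n _ = contradiction (ℕ.divides 1 refl) 2∤n
lucas-legendre3 3 _ 3∤n = contradiction (ℕ.divides 1 refl) 3∤n
lucas-legendre3 4 2∤n _ = contradiction (ℕ.divides 2 refl) 2∤n
lucas-legendre3 5 _ _   = refl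
lucas-legendre3 (suc (suc (suc (suc (suc (suc n)))))) 2∤n 3∤n = begin
  + 2 * U (6 ℕ.+ n) - V (6 ℕ.+ n)
    ≡⟨ cong₂ (λ a b → + 2 * a - b)
         (trans (U+3 (3 ℕ.+ n)) (trans (cong -_ (U+3 n)) (ℤ.neg-involutive (U n))))
         (trans (V+3 (3 ℕ.+ n)) (V+3 n)) ⟩
  + 2 * U n - V n
    ≡⟨ lucas-legendre3 n (λ 2∣n → 2∤n (ℕ.∣m∣n⇒∣m+n (ℕ.divides 3 refl) 2∣n))
         (λ 3∣n → 3∤n (ℕ.∣m∣n⇒∣m+n (ℕ.divides 2 refl) 3∣n)) ⟩
  -- `legendre3 (6 ℕ.+ n)` computes to `legendre3 n`.
  legendre3 n ∎
  where
  open ≡-Reasoning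
  U V : ℕ → ℤ
  U = lucasU (+ 1) (+ 1)
  V = lucasU (- + 1) (+ 1)
  U+3 : ∀ n → U (3 ℕ.+ n) ≡ - U n
  U+3 n = ring (U (suc n)) (U n)
    where
    ring : ∀ a b → + 1 * (+ 1 * a - + 1 * b) - + 1 * a ≡ - b
    ring = solve-∀
  V+3 : ∀ n → V (3 ℕ.+ n) ≡ V n
  V+3 n = ring (V (suc n)) (V n)
    where
    ring : ∀ a b → - + 1 * (- + 1 * a - + 1 * b) - + 1 * a ≡ b
    ring = solve-∀

-- Binet's formula: X² - X - 2 has the roots 2 and -1, whose difference is 3.
lucas-1,-2 : ∀ n → + 3 * lucasU (+ 1) (- + 2) n ≡ (+ 2) ^ n - -1ℤ ^ n
lucas-1,-2 zero          = refl
lucas-1,-2 (suc zero)    = refl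
lucas-1,-2 (suc (suc n)) = trans (ring₁ (U (suc n)) (U n))
  (trans (cong₂ (λ a b → a + + 2 * b) (lucas-1,-2 (suc n)) (lucas-1,-2 n)) (ring₂ ((+ 2) ^ n) (-1ℤ ^ n)))
  where
  U = lucasU (+ 1) (- + 2)
  ring₁ : ∀ a b → + 3 * (+ 1 * a - - + 2 * b) ≡ + 3 * a + + 2 * (+ 3 * b)
  ring₁ = solve-∀
  ring₂ : ∀ t e → + 2 * t - -1ℤ * e + + 2 * (t - e) ≡ + 2 * (+ 2 * t) - -1ℤ * (-1ℤ * e)
  ring₂ = solve-∀

-- Binet's formula for X² - 5X + 4, with roots 4 and 1; these are the parameters 1 - 2x and x² at x
-- = -2.
lucas-5,4 : ∀ n → + 3 * lucasU (+ 5) (+ 4) n ≡ (+ 4) ^ n - 1ℤ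
lucas-5,4 zero          = refl
lucas-5,4 (suc zero)    = refl
lucas-5,4 (suc (suc n)) = trans (ring₁ (V (suc n)) (V n))
  (trans (cong₂ (λ a b → + 5 * a - + 4 * b) (lucas-5,4 (suc n)) (lucas-5,4 n)) (ring₂ ((+ 4) ^ n)))
  where
  V = lucasU (+ 5) (+ 4)
  ring₁ : ∀ a b → + 3 * (+ 5 * a - + 4 * b) ≡ + 5 * (+ 3 * a) - + 4 * (+ 3 * b)
  ring₁ = solve-∀
  ring₂ : ∀ t → + 5 * (+ 4 * t - 1ℤ) - + 4 * (t - 1ℤ) ≡ + 4 * (+ 4 * t) - 1ℤ
  ring₂ = solve-∀

-- Odd primes, and the divisibility statements for the quotient

parity : ∀ n → ∃ λ h → n ≡ h ℕ.+ h ⊎ n ≡ suc (h ℕ.+ h)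
parity zero    = 0 , inj₁ refl
parity (suc n) with parity n
... | h , inj₁ refl = h , inj₂ refl
... | h , inj₂ refl = suc h , inj₁ (cong suc (sym (ℕ.+-suc h h)))

prime∤ : ∀ {p} → Prime p → ∀ d → suc (suc d) ℕ.< p → ¬ suc (suc d) ℕ.∣ p
prime∤ pp d d<p d∣p with prime⇒irreducible pp d∣p
... | inj₁ ()
... | inj₂ d≡p = ℕ.<⇒≢ d<p d≡p

odd-prime : ∀ {p} → Prime p → 2 ℕ.< p → ∃ λ h → p ≡ suc (suc h ℕ.+ suc h)
odd-prime {p} pp 2<p with parity p
... | h     , inj₁ p≡2h = contradiction
  (ℕ.divides h (trans p≡2h (trans (cong (h ℕ.+_) (sym (ℕ.+-identityʳ h))) (ℕ.*-comm 2 h)))) (prime∤ pp 0 2<p)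
... | zero  , inj₂ refl = contradiction 2<p λ { (s≤s ()) }
... | suc h , inj₂ p≡   = h , p≡

-- Division by p is expressed through an arbitrary `q` with `aperySum p x ≡ + p * q`; cancellation
-- identifies it with the explicit quotient.
aperyQuotient-unique : ∀ n x q → aperySum (suc n) x ≡ + suc n * q → aperyQuotient n x ≡ q
aperyQuotient-unique n x q e = ℤ.*-cancelˡ-≡ (+ suc n) _ _ (trans (sym (aperySum≡ n x)) e)

-1^even : ∀ h → -1ℤ ^ (h ℕ.+ h) ≡ 1ℤ
-1^even h = trans (ℤ.^-distribˡ-+-* -1ℤ h h) (-1^n*-1^n≡1 h)

quotient≅centralSum : ∀ h x q → Prime (suc (h ℕ.+ h)) → let p = suc (h ℕ.+ h) in
  aperySum p x ≡ + p * q → q ≅ sumTo p (λ k → bin (k ℕ.+ k) k * x ^ k) mod (+ p * + p)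
quotient≅centralSum h x q pp e = ≅-trans (≅-reflexive (sym (aperyQuotient-unique (h ℕ.+ h) x q e)))
  (aperyQuotient≅ pp (-1^even h) x)

≅⇒p²∣ : ∀ p {a b} → a ≅ b mod (+ p * + p) → (+ (p ℕ.^ 2)) ∣ (a - b)
≅⇒p²∣ p {a} {b} e = ≅0⇒∣ (subst (λ z → a - b ≅ 0ℤ mod z)
  (trans (sym (ℤ.pos-* p p)) (cong (λ z → + (p ℕ.* z)) (sym (ℕ.*-identityʳ p)))) (≅⇒-≅0 e))

theorem1p1 : ((x : ℤ) (n : ℕ) → n > 0 → (+ n) ∣ aperySum n x)
    × ((x : ℤ) (p : ℕ) → Prime p → p > 2 → (q : ℤ) → aperySum p x ≡ + p * q →
    (+ p) ∣ (q - legendre (+ 1 - + 4 * x) p))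
    × ((p : ℕ) → Prime p → p > 3 → (q : ℤ) → aperySum p (+ 1) ≡ + p * q →
    (+ (p ℕ.^ 2)) ∣ (q - legendre3 p))
    × ((p : ℕ) → Prime p → p > 3 → (q : ℤ) → aperySum p (- (+ 2)) ≡ + p * q →
    (+ (p ℕ.^ 2)) ∣ (+ 3 * q - (+ 3 - + 4 * ((+ 2) ^ (p ℕ.∸ 1) - + 1))))
theorem1p1 = part-i , part-ii , part-iii₁ , part-iii₂
  where
  part-i : (x : ℤ) (n : ℕ) → n > 0 → (+ n) ∣ aperySum n x
  part-i x (suc n) _ = ≅0⇒∣ (≅-trans
    (≅-reflexive (trans (aperySum≡ n x) (ℤ.*-comm (+ suc n) (aperyQuotient n x))))
    (multiple≅0 (aperyQuotient n x)))

  part-ii : (x : ℤ) (p : ℕ) → Prime p → p > 2 → (q : ℤ) → aperySum p x ≡ + p * q →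
    (+ p) ∣ (q - legendre (+ 1 - + 4 * x) p)
  part-ii x p pp p>2 q e with odd-prime pp p>2
  ... | h , refl = ≅0⇒∣ (≅⇒-≅0 (≅-trans
    (≅-weaken {+ p} (+ p) (quotient≅centralSum (suc h) x q pp e))
    (≅-trans (centralSum≅ (suc h) pp x) (euler-criterion h pp (+ 1 - + 4 * x)))))

  part-iii₁ : (p : ℕ) → Prime p → p > 3 → (q : ℤ) → aperySum p (+ 1) ≡ + p * q →
    (+ (p ℕ.^ 2)) ∣ (q - legendre3 p)
  part-iii₁ p pp p>3 q e with odd-prime pp (ℕ.<-trans (ℕ.n<1+n 2) p>3)
  ... | h , refl = ≅⇒p²∣ p (≅-trans (quotient≅centralSum (suc h) (+ 1) q pp e)
    (≅-trans (centralSum≅lucas (+ 1) pp) (≅-reflexive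
      (lucas-legendre3 p (prime∤ pp 0 (ℕ.<-trans (ℕ.n<1+n 2) p>3)) (prime∤ pp 1 p>3)))))

  -- The factor 3 clears the denominator of 4/3; it is a unit modulo p² because p > 3.
  part-iii₂ : (p : ℕ) → Prime p → p > 3 → (q : ℤ) → aperySum p (- (+ 2)) ≡ + p * q →
    (+ (p ℕ.^ 2)) ∣ (+ 3 * q - (+ 3 - + 4 * ((+ 2) ^ (p ℕ.∸ 1) - + 1)))
  part-iii₂ p pp p>3 q e with odd-prime pp (ℕ.<-trans (ℕ.n<1+n 2) p>3)
  ... | h , refl = ≅⇒p²∣ p (begin
    + 3 * q
      ≈⟨ ≅-*ˡ (+ 3) (≅-trans (quotient≅centralSum (suc h) (- + 2) q pp e) (centralSum≅lucas (- + 2) pp)) ⟩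
    + 3 * (+ 2 * U p - V p)
      ≡⟨ ring₁ (U p) (V p) ⟩
    + 2 * (+ 3 * U p) - + 3 * V p
      ≡⟨ cong₂ (λ a b → + 2 * a - b) (lucas-1,-2 p) (lucas-5,4 p) ⟩
    + 2 * (+ 2 * t - -1ℤ * -1ℤ ^ n) - (+ 4 * (+ 4) ^ n - 1ℤ)
      ≡⟨ cong₂ (λ a b → + 2 * (+ 2 * t - -1ℤ * a) - (+ 4 * b - 1ℤ)) (-1^even (suc h)) (^-distrib-* (+ 2) (+ 2) n) ⟩
    + 2 * (+ 2 * t - -1ℤ * 1ℤ) - (+ 4 * (t * t) - 1ℤ)
      -- The exact value differs from the desired one by -4(t - 1)², which vanishes modulo p²
      -- because t ≡ 1 modulo p by Fermat.
      ≡⟨ ring₂ t ⟩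
    + 3 - + 4 * (t - + 1) - + 4 * ((t - + 1) * (t - + 1))
      ≈⟨ ≅-minus (≅-refl {a = + 3 - + 4 * (t - + 1)}) (≅-*ˡ (+ 4) (≅0-*-lift t≅1 t≅1)) ⟩
    + 3 - + 4 * (t - + 1) - + 4 * ((t - + 1) * 0ℤ)
      ≡⟨ ring₃ t ⟩
    + 3 - + 4 * (t - + 1) ∎)
    where
    open ≅-Reasoning (+ p * + p)
    n = suc h ℕ.+ suc h
    t = (+ 2) ^ n
    U = lucasU (+ 1) (- + 2)
    V = lucasU (+ 5) (+ 4)
    t≅1 : t - + 1 ≅ 0ℤ mod (+ p)
    t≅1 = ≅⇒-≅0 (fermat pp 2 (<⇒≇0 (ℕ.<-trans (ℕ.n<1+n 2) p>3)))
    ring₁ : ∀ a b → + 3 * (+ 2 * a - b) ≡ + 2 * (+ 3 * a) - + 3 * b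
    ring₁ = solve-∀
    ring₂ : ∀ t → + 2 * (+ 2 * t - -1ℤ * 1ℤ) - (+ 4 * (t * t) - 1ℤ) ≡
      + 3 - + 4 * (t - + 1) - + 4 * ((t - + 1) * (t - + 1))
    ring₂ = solve-∀
    ring₃ : ∀ t → + 3 - + 4 * (t - + 1) - + 4 * ((t - + 1) * 0ℤ) ≡ + 3 - + 4 * (t - + 1)
    ring₃ = solve-∀
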